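{- Let $\ell$ and $m$ be positive integers with $3\nmid\ell$, and write $q:=2^m$ and $n:=\lfloor(q+1)/3\rfloor$. Let $a\in\mathbb{F}_q\setminus\mathbb{F}_2$ satisfy $\mathrm{Tr}(1/a)=\mathrm{Tr}(1)$, and let $N_\ell$ be the number of roots in $\mathbb{F}_{q^3}$ of $X^{2q^\ell+1}+X+a$. Then: (1) if $\ell\not\equiv -m\pmod 3$ then $N_\ell=3$; (2) if $\ell\equiv -m\pmod 3$ then $N_\ell\in\{0,9\}$, and $N_\ell=9$ if and only if $D_n(a)=0$.
   Context: $\mathrm{Tr}$ denotes the trace map from $\mathbb{F}_q$ to $\mathbb{F}_2$. For a positive integer $n$, $D_n(X)\in\mathbb{F}_2[X]$ is the Dickson polynomial of the first kind of degree $n$ with parameter $1$, i.e. the unique polynomial satisfying $D_n(X+X^{ -1})=X^n+X^{ -n}$. -}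

module Defs where

open import Level using (0ℓ)
open import Data.Nat using (ℕ; zero; suc; _^_)
open import Data.Fin using (Fin)
open import Data.List using (List; length; filter; map) renaming (allFin to allFinL)
open import Relation.Binary.PropositionalEquality using (_≡_; _≢_)
open import Relation.Binary.Definitions using (DecidableEquality)
open import Relation.Nullary using (Dec)
open import Algebra.Structures using (IsCommutativeRing)
open import Function.Bundles using (_↔_; Inverse)

record GF2Field (k : ℕ) : Set₁ where
  infixl 7 _*_
  infixl 6 _+_
  field
    Carrier : Set
    _+_ _*_ : Carrier → Carrier → Carrier
    -_      : Carrier → Carrier
    0# 1#   : Carrier
    isCommutativeRing : IsCommutativeRing _≡_ _+_ _*_ -_ 0# 1#
    _⁻¹     : Carrier → Carrier
    0≢1     : 0# ≢ 1#
    inverseʳ : ∀ x → x ≢ 0# → x * (x ⁻¹) ≡ 1#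
    char2   : 1# + 1# ≡ 0#
    _≟_     : DecidableEquality Carrier
    enum    : Fin (2 ^ k) ↔ Carrier

  pow : Carrier → ℕ → Carrier
  pow x zero    = 1#
  pow x (suc n) = x * pow x n

  Tr : ℕ → Carrier → Carrier
  Tr zero    x = 0#
  Tr (suc i) x = Tr i x + pow x (2 ^ i)

  -- Dickson polynomial of the first kind with parameter 1, evaluated at x:
  -- D_0 = 2 = 0 (char 2), D_1 = X, D_{n+2} = X D_{n+1} - D_n
  dickson : ℕ → Carrier → Carrier
  dickson zero x = 1# + 1#
  dickson (suc zero) x = x
  dickson (suc (suc n)) x = x * dickson (suc n) x + (- dickson n x)

  elements : List Carrier
  elements = map (Inverse.to enum) (allFinL (2 ^ k))

  numRoots : (Carrier → Carrier) → ℕ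
  numRoots f = length (filter (λ x → f x ≟ 0#) elements)

{-# OPTIONS --safe #-}
-- The map φ(x) = a/(x + 1)² commutes with σ(x) = x^(q^ℓ), and the roots are the x
-- with x = φ(σ x); they all satisfy φ³(x) = x.  The fixed points r₁, r₂, r₃ of φ are
-- the roots of X³ + X + a.  In the coordinate s that sends r₁, r₂, r₃ to 0, 1, ∞ the
-- map φ becomes s ↦ s², so that the roots lie over P¹(𝔽₈), on which σ acts as
-- a power of the Frobenius map, composed with the permutation that σ induces on
-- 0, 1, ∞.
--
-- That permutation is governed by δ = D_n(a).  If a = t + 1/t, the trace condition
-- says that t^(q-1) = 1 for even m and t^(q+1) = 1 for odd m, so t^(3n) = 1 and
-- δ ∈ {0, 1}.  A root x = u + 1/u of X³ + X + a has u³ = t (or u³ = 1/t), hence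
-- x^q = D_{3n±1}(x), which is x if δ = 0 and another root if δ = 1.  Neither t nor
-- u needs to exist in the proof: Dickson identities replace them.  Carried out for
-- the class of X in K[X]/(X³ + X + a) they give X^(q³) = X there, which is why the
-- cubic splits in K.
module Submission where

open import Defs
open import Algebra.Bundles using (RawRing; CommutativeRing)
open import Algebra.Solver.Ring.AlmostCommutativeRing
  using (AlmostCommutativeRing; fromCommutativeSemiring; _-Raw-AlmostCommutative⟶_)
open import Algebra.Structures using (IsCommutativeRing)
import Algebra.Properties.CommutativeSemiring.Exp
import Algebra.Solver.Ring
open import Data.Bool.Base using (Bool; true; false; _xor_; _∧_)
open import Data.List.Base using (List; []; _∷_; _++_; length; filter; map; foldr; allFin)
open import Data.List.Membership.Propositional using (_∈_)
open import Data.List.Membership.Propositional.Properties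
  using (∈-map⁺; ∈-map⁻; ∈-filter⁺; ∈-filter⁻; ∈-allFin; ∈-++⁺ˡ; ∈-++⁺ʳ; ∈-++⁻)
open import Data.List.Membership.Propositional.Properties.WithK using (unique∧set⇒bag)
open import Data.List.Properties using (length-map; length-tabulate)
open import Data.List.Relation.Binary.BagAndSetEquality using (∼bag⇒↭)
open import Data.List.Relation.Binary.Permutation.Propositional using (_↭_; ↭⇒↭ₛ)
open import Data.List.Relation.Binary.Permutation.Propositional.Properties using (↭-length)
import Data.List.Relation.Binary.Permutation.Setoid.Properties as Permutationₛ
open import Data.List.Relation.Unary.All as All using (All; []; _∷_)
import Data.List.Relation.Unary.All.Properties as All
open import Data.List.Relation.Unary.AllPairs using ([]; _∷_)
open import Data.List.Relation.Unary.Any as Any using (here; there)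
open import Data.List.Relation.Unary.Unique.Propositional using (Unique)
import Data.List.Relation.Unary.Unique.Propositional.Properties as Unique
open import Data.Maybe.Base using (Maybe; just; nothing)
open import Data.Nat.Base as ℕ using (ℕ; zero; suc)
open import Data.Nat.Divisibility using (_∣_; divides; ∣m+n∣m⇒∣n; >⇒∤)
open import Data.Nat.DivMod using (+-distrib-/-∣ʳ; m*n/n≡m)
import Data.Nat.Properties as ℕₚ
open import Data.Nat.Solver using (module +-*-Solver)
open import Data.Product.Base using (∃; ∃₂; _×_; _,_; proj₁; proj₂)
open import Data.Sum.Base using (_⊎_; inj₁; inj₂; [_,_]′)
open import Data.Vec.Base using (Vec; []; _∷_; replicate)
open import Function.Base using (id; _∘_)
open import Function.Bundles using (_⇔_; mk⇔; Inverse)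
open import Level using (0ℓ)
open import Relation.Binary.PropositionalEquality
  using (_≡_; _≢_; refl; sym; trans; cong; cong₂; subst; isEquivalence; setoid; module ≡-Reasoning)
open import Relation.Nullary using (¬_; Dec; yes; no; contradiction)
open import Relation.Nullary.Decidable using (¬?)
open +-*-Solver using ()
  renaming (solve to ℕsolve; _:+_ to _⊕_; _:*_ to _⊗_; _:=_ to _⊜_; con to κ; Polynomial to ℕPolynomial)

-- A root satisfies x = a/((σ x)² + 1); iterating gives x = φ³(σ³ x), and σ³ is the identity on K.
-- The map φ is squaring followed by a Möbius map, and every change of coordinate preserves this
-- form. Once φ fixes 0, 1 and ∞, the Möbius factor fixes three points and is trivial: hence s ↦ s²,
-- and φ³(x) = x becomes s⁸ = s. The obstacle is existence: t and u may lie outside K, and no root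
-- of the cubic in K is given. The Dickson identities are therefore proved over every commutative
-- ring of characteristic 2, so that they apply in K[X]/(X³ + X + a), which is not a domain. They
-- determine x^q only through its square; squares can be cancelled there because a ≠ 0 makes the
-- cubic separable. Then X^(q³) = X says that the cubic divides X^(q³) + X, which vanishes on all of
-- K, while the cofactor of degree q³ - 3 has too few roots to account for that.

record CharTwoRing : Set₁ where
  infixl 7 _*_
  infixl 6 _+_
  field
    Carrier           : Set
    _+_ _*_           : Carrier → Carrier → Carrier
    -_                : Carrier → Carrier
    0# 1#             : Carrier
    isCommutativeRing : IsCommutativeRing _≡_ _+_ _*_ -_ 0# 1#
    1+1≡0             : 1# + 1# ≡ 0#

-- Dickson identities in rings of characteristic 2

module CharTwoTheory (R : CharTwoRing) where

  open CharTwoRing R renaming (Carrier to C)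

  ring : CommutativeRing 0ℓ 0ℓ
  ring = record { isCommutativeRing = isCommutativeRing }

  open CommutativeRing ring using
    ( commutativeSemiring; +-identityˡ; +-identityʳ; *-identityˡ; *-identityʳ
    ; zeroˡ; zeroʳ; +-assoc; +-comm; *-assoc; *-comm; distribˡ; distribʳ; -‿inverseʳ) public
  open Algebra.Properties.CommutativeSemiring.Exp commutativeSemiring public
    using (_^_; ^-homo-*; ^-assocʳ; ^-distrib-*)

  double : ∀ x → x + x ≡ 0#
  double x = begin
    x + x                 ≡⟨ cong₂ _+_ (*-identityʳ x) (*-identityʳ x) ⟨
    (x * 1#) + (x * 1#)   ≡⟨ distribˡ x 1# 1# ⟨
    x * (1# + 1#)         ≡⟨ cong (x *_) 1+1≡0 ⟩
    x * 0#                ≡⟨ zeroʳ x ⟩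
    0#                    ∎
    where open ≡-Reasoning

  private
    -- With coefficients in 𝔽₂ the normal forms of the solver cancel equal terms, so identities
    -- special to characteristic 2 hold by `refl`.
    𝔽₂ : RawRing 0ℓ 0ℓ
    𝔽₂ = record
      { Carrier = Bool ; _≈_ = _≡_ ; _+_ = _xor_ ; _*_ = _∧_ ; -_ = id
      ; 0# = false ; 1# = true }

    almostRing : AlmostCommutativeRing 0ℓ 0ℓ
    almostRing = fromCommutativeSemiring commutativeSemiring

    bit : Bool → C
    bit false = 0#
    bit true  = 1#

    𝔽₂⟶ring : 𝔽₂ -Raw-AlmostCommutative⟶ almostRing
    𝔽₂⟶ring = record
      { ⟦_⟧    = bit
      ; +-homo = λ { false y → sym (+-identityˡ (bit y)) ; true false → sym (+-identityʳ 1#) ; true true → sym 1+1≡0 }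
      ; *-homo = λ { false y → sym (zeroˡ (bit y)) ; true y → sym (*-identityˡ (bit y)) }
      ; -‿homo = λ _ → refl
      ; 0-homo = refl
      ; 1-homo = refl
      }

    bit≟ : ∀ x y → Maybe (bit x ≡ bit y)
    bit≟ false false = just refl
    bit≟ true  true  = just refl
    bit≟ _     _     = nothing

  open Algebra.Solver.Ring 𝔽₂ almostRing 𝔽₂⟶ring bit≟ public
    using (solve; _:=_; _:+_; _:*_; _:^_; Polynomial; con)

  :0 :1 : ∀ {n} → Polynomial n
  :0 = con false
  :1 = con true

  +≡0⇒≡ : ∀ {x y} → x + y ≡ 0# → x ≡ y
  +≡0⇒≡ {x} {y} eq = begin
    x             ≡⟨ solve 2 (λ x y → x := (x :+ y) :+ y) refl x y ⟩
    (x + y) + y   ≡⟨ cong (_+ y) eq ⟩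
    0# + y        ≡⟨ +-identityˡ y ⟩
    y             ∎
    where open ≡-Reasoning

  ≡⇒+≡0 : ∀ {x y} → x ≡ y → x + y ≡ 0#
  ≡⇒+≡0 {x} refl = double x

  neg≡id : ∀ x → - x ≡ x
  neg≡id x = sym (+≡0⇒≡ (-‿inverseʳ x))

  -- Dickson polynomials

  dickson : ℕ → C → C
  dickson zero          x = 0#
  dickson (suc zero)    x = x
  dickson (suc (suc k)) x = (x * dickson (suc k) x) + dickson k x

  dickson-0 : ∀ k → dickson k 0# ≡ 0#
  dickson-0 zero          = refl
  dickson-0 (suc zero)    = refl
  dickson-0 (suc (suc k)) = begin
    (0# * dickson (suc k) 0#) + dickson k 0#  ≡⟨ cong₂ _+_ (zeroˡ _) (dickson-0 k) ⟩
    0# + 0#                                   ≡⟨ +-identityˡ 0# ⟩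
    0#                                        ∎
    where open ≡-Reasoning

  dickson-3 : ∀ x → dickson 3 x ≡ (x ^ 3) + x
  dickson-3 = solve 1 (λ x → x :* (x :* x :+ :0) :+ x := x :^ 3 :+ x) refl

  -- The indices i + 2k and i stand for the pair (u + v, u − v) in
  -- D_{u+v} + D_{u−v} = D_u D_v, which avoids truncated subtraction.
  dickson-sum : ∀ k i x → dickson (k ℕ.+ (k ℕ.+ i)) x + dickson i x ≡ dickson (k ℕ.+ i) x * dickson k x
  dickson-sum zero i x = trans (double _) (sym (zeroʳ _))
  dickson-sum (suc zero) i x =
    solve 3 (λ x d e → (x :* d :+ e) :+ e := d :* x) refl x (dickson (suc i) x) (dickson i x)
  dickson-sum (suc (suc k)) i x = begin
    D (2 ℕ.+ k ℕ.+ (2 ℕ.+ k ℕ.+ i)) + D i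
      ≡⟨ cong (λ j → D j + D i) ix₁ ⟩
    (x * D (1 ℕ.+ J)) + D J + D i
      ≡⟨ solve 5 (λ x p q e f → x :* p :+ q :+ e := x :* (p :+ f) :+ (q :+ (x :* f :+ e)))
          refl x (D (1 ℕ.+ J)) (D J) (D i) (D (1 ℕ.+ i)) ⟩
    x * (D (1 ℕ.+ J) + D (1 ℕ.+ i)) + (D J + D (2 ℕ.+ i))
      ≡⟨ cong₂ (λ u v → x * (D u + D (1 ℕ.+ i)) + (D v + D (2 ℕ.+ i))) ix₂ ix₃ ⟩
    x * (D (1 ℕ.+ k ℕ.+ (1 ℕ.+ k ℕ.+ (1 ℕ.+ i))) + D (1 ℕ.+ i)) + (D (k ℕ.+ (k ℕ.+ (2 ℕ.+ i))) + D (2 ℕ.+ i))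
      ≡⟨ cong₂ (λ u v → x * u + v) (dickson-sum (suc k) (suc i) x) (dickson-sum k (2 ℕ.+ i) x) ⟩
    x * (D (1 ℕ.+ k ℕ.+ (1 ℕ.+ i)) * D (1 ℕ.+ k)) + D (k ℕ.+ (2 ℕ.+ i)) * D k
      ≡⟨ cong₂ (λ u v → x * (D u * D (1 ℕ.+ k)) + D v * D k) ix₄ ix₅ ⟩
    x * (D (2 ℕ.+ k ℕ.+ i) * D (1 ℕ.+ k)) + D (2 ℕ.+ k ℕ.+ i) * D k
      ≡⟨ solve 4 (λ x e p q → x :* (e :* p) :+ e :* q := e :* (x :* p :+ q))
          refl x (D (2 ℕ.+ k ℕ.+ i)) (D (1 ℕ.+ k)) (D k) ⟩
    D (2 ℕ.+ k ℕ.+ i) * D (2 ℕ.+ k) ∎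
    where
    open ≡-Reasoning
    D = λ j → dickson j x
    J = 2 ℕ.+ (k ℕ.+ (k ℕ.+ i))
    ix₁ : 2 ℕ.+ k ℕ.+ (2 ℕ.+ k ℕ.+ i) ≡ 2 ℕ.+ J
    ix₁ = ℕsolve 2 (λ k i → κ 2 ⊕ k ⊕ (κ 2 ⊕ k ⊕ i) ⊜ κ 2 ⊕ (κ 2 ⊕ (k ⊕ (k ⊕ i)))) refl k i
    ix₂ : 1 ℕ.+ J ≡ 1 ℕ.+ k ℕ.+ (1 ℕ.+ k ℕ.+ (1 ℕ.+ i))
    ix₂ = ℕsolve 2 (λ k i → κ 1 ⊕ (κ 2 ⊕ (k ⊕ (k ⊕ i))) ⊜ κ 1 ⊕ k ⊕ (κ 1 ⊕ k ⊕ (κ 1 ⊕ i))) refl k i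
    ix₃ : J ≡ k ℕ.+ (k ℕ.+ (2 ℕ.+ i))
    ix₃ = ℕsolve 2 (λ k i → κ 2 ⊕ (k ⊕ (k ⊕ i)) ⊜ k ⊕ (k ⊕ (κ 2 ⊕ i))) refl k i
    ix₄ : 1 ℕ.+ k ℕ.+ (1 ℕ.+ i) ≡ 2 ℕ.+ k ℕ.+ i
    ix₄ = ℕsolve 2 (λ k i → κ 1 ⊕ k ⊕ (κ 1 ⊕ i) ⊜ κ 2 ⊕ k ⊕ i) refl k i
    ix₅ : k ℕ.+ (2 ℕ.+ i) ≡ 2 ℕ.+ k ℕ.+ i
    ix₅ = ℕsolve 2 (λ k i → k ⊕ (κ 2 ⊕ i) ⊜ κ 2 ⊕ k ⊕ i) refl k i

  dickson-double : ∀ k x → dickson (k ℕ.+ (k ℕ.+ 0)) x ≡ dickson k x * dickson k x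
  dickson-double k x = begin
    dickson (k ℕ.+ (k ℕ.+ 0)) x           ≡⟨ +-identityʳ _ ⟨
    dickson (k ℕ.+ (k ℕ.+ 0)) x + 0#      ≡⟨ dickson-sum k 0 x ⟩
    dickson (k ℕ.+ 0) x * dickson k x     ≡⟨ cong (λ j → dickson j x * dickson k x) (ℕₚ.+-identityʳ k) ⟩
    dickson k x * dickson k x             ∎
    where open ≡-Reasoning

  -- This is D_{u+v} D_{u-v} = D_u² + D_v² for u = k + i and v = k: the sum formula turns the
  -- product into D_{2u} + D_{2v}, and doubling an index squares the value.
  dickson-product : ∀ k i x → dickson (k ℕ.+ (k ℕ.+ i)) x * dickson i x
                    ≡ dickson (k ℕ.+ i) x * dickson (k ℕ.+ i) x + dickson k x * dickson k x
  dickson-product k i x = begin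
    D (k ℕ.+ (k ℕ.+ i)) * D i                       ≡⟨ cong (λ j → D j * D i) ix₁ ⟩
    D (i ℕ.+ (k ℕ.+ (k ℕ.+ 0))) * D i               ≡⟨ dickson-sum i (k ℕ.+ (k ℕ.+ 0)) x ⟨
    D (i ℕ.+ (i ℕ.+ (k ℕ.+ (k ℕ.+ 0)))) + D (k ℕ.+ (k ℕ.+ 0))
      ≡⟨ cong₂ (λ j e → D j + e) ix₂ (dickson-double k x) ⟩
    D (k ℕ.+ i ℕ.+ (k ℕ.+ i ℕ.+ 0)) + D k * D k     ≡⟨ cong (_+ D k * D k) (dickson-double (k ℕ.+ i) x) ⟩
    D (k ℕ.+ i) * D (k ℕ.+ i) + D k * D k           ∎
    where
    open ≡-Reasoning
    D = λ j → dickson j x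
    ix₁ : k ℕ.+ (k ℕ.+ i) ≡ i ℕ.+ (k ℕ.+ (k ℕ.+ 0))
    ix₁ = ℕsolve 2 (λ k i → k ⊕ (k ⊕ i) ⊜ i ⊕ (k ⊕ (k ⊕ κ 0))) refl k i
    ix₂ : i ℕ.+ (i ℕ.+ (k ℕ.+ (k ℕ.+ 0))) ≡ k ℕ.+ i ℕ.+ (k ℕ.+ i ℕ.+ 0)
    ix₂ = ℕsolve 2 (λ k i → i ⊕ (i ⊕ (k ⊕ (k ⊕ κ 0))) ⊜ k ⊕ i ⊕ (k ⊕ i ⊕ κ 0)) refl k i

  dickson-∘ : ∀ j k x → dickson j (dickson k x) ≡ dickson (j ℕ.* k) x
  dickson-∘ zero          k x = refl
  dickson-∘ (suc zero)    k x = cong (λ i → dickson i x) (sym (ℕₚ.+-identityʳ k))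
  dickson-∘ (suc (suc j)) k x = begin
    D k * dickson (suc j) (D k) + dickson j (D k)
      ≡⟨ cong₂ (λ u v → D k * u + v) (dickson-∘ (suc j) k x) (dickson-∘ j k x) ⟩
    D k * D (k ℕ.+ j ℕ.* k) + D (j ℕ.* k)
      ≡⟨ cong (_+ D (j ℕ.* k)) (trans (*-comm _ _) (sym (dickson-sum k (j ℕ.* k) x))) ⟩
    D (k ℕ.+ (k ℕ.+ j ℕ.* k)) + D (j ℕ.* k) + D (j ℕ.* k)
      ≡⟨ solve 2 (λ u v → u :+ v :+ v := u) refl _ _ ⟩
    D (k ℕ.+ (k ℕ.+ j ℕ.* k)) ∎
    where
    open ≡-Reasoning
    D = λ j → dickson j x

  ^-2^suc : ∀ x k → x ^ (2 ℕ.^ suc k) ≡ x ^ (2 ℕ.^ k) * x ^ (2 ℕ.^ k)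
  ^-2^suc x k = begin
    x ^ (2 ℕ.^ k ℕ.+ (2 ℕ.^ k ℕ.+ 0))   ≡⟨ cong (λ e → x ^ (2 ℕ.^ k ℕ.+ e)) (ℕₚ.+-identityʳ (2 ℕ.^ k)) ⟩
    x ^ (2 ℕ.^ k ℕ.+ 2 ℕ.^ k)           ≡⟨ ^-homo-* x (2 ℕ.^ k) (2 ℕ.^ k) ⟩
    x ^ (2 ℕ.^ k) * x ^ (2 ℕ.^ k)       ∎
    where open ≡-Reasoning

  -- Doubling the index squares the value, so the powers of Frobenius are themselves Dickson
  -- polynomials. This is how x^q enters the index arithmetic.
  dickson-2^ : ∀ k x → dickson (2 ℕ.^ k) x ≡ x ^ (2 ℕ.^ k)
  dickson-2^ zero    x = sym (*-identityʳ x)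
  dickson-2^ (suc k) x = begin
    dickson (2 ℕ.^ k ℕ.+ (2 ℕ.^ k ℕ.+ 0)) x       ≡⟨ dickson-double (2 ℕ.^ k) x ⟩
    dickson (2 ℕ.^ k) x * dickson (2 ℕ.^ k) x     ≡⟨ cong₂ _*_ (dickson-2^ k x) (dickson-2^ k x) ⟩
    x ^ (2 ℕ.^ k) * x ^ (2 ℕ.^ k)                 ≡⟨ ^-2^suc x k ⟨
    x ^ (2 ℕ.^ suc k)                             ∎
    where open ≡-Reasoning

  frobenius-+ : ∀ k x y → (x + y) ^ (2 ℕ.^ k) ≡ x ^ (2 ℕ.^ k) + y ^ (2 ℕ.^ k)
  frobenius-+ zero    x y = solve 2 (λ x y → (x :+ y) :^ 1 := x :^ 1 :+ y :^ 1) refl x y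
  frobenius-+ (suc k) x y = begin
    (x + y) ^ (2 ℕ.^ suc k)         ≡⟨ ^-2^suc (x + y) k ⟩
    (x + y) ^ Q * (x + y) ^ Q       ≡⟨ cong (λ e → e * e) (frobenius-+ k x y) ⟩
    (x ^ Q + y ^ Q) * (x ^ Q + y ^ Q)
      ≡⟨ solve 2 (λ u v → (u :+ v) :* (u :+ v) := u :* u :+ v :* v) refl (x ^ Q) (y ^ Q) ⟩
    x ^ Q * x ^ Q + y ^ Q * y ^ Q   ≡⟨ cong₂ _+_ (^-2^suc x k) (^-2^suc y k) ⟨
    x ^ (2 ℕ.^ suc k) + y ^ (2 ℕ.^ suc k) ∎
    where
    open ≡-Reasoning
    Q = 2 ℕ.^ k

  1^ : ∀ k → 1# ^ k ≡ 1#
  1^ zero    = refl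
  1^ (suc k) = trans (*-identityˡ _) (1^ k)

  ^-2^[3*] : ∀ m x → ((x ^ (2 ℕ.^ m)) ^ (2 ℕ.^ m)) ^ (2 ℕ.^ m) ≡ x ^ (2 ℕ.^ (3 ℕ.* m))
  ^-2^[3*] m x = begin
    ((x ^ q) ^ q) ^ q           ≡⟨ cong (_^ q) (^-assocʳ x q q) ⟩
    (x ^ (q ℕ.* q)) ^ q         ≡⟨ ^-assocʳ x (q ℕ.* q) q ⟩
    x ^ (q ℕ.* q ℕ.* q)         ≡⟨ cong (x ^_) (ℕsolve 1 (λ q → q ⊗ q ⊗ q ⊜ q ⊗ (q ⊗ (q ⊗ κ 1))) refl q) ⟩
    x ^ (q ℕ.^ 3)               ≡⟨ cong (x ^_) (trans (ℕₚ.^-*-assoc 2 m 3) (cong (2 ℕ.^_) (ℕₚ.*-comm m 3))) ⟩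
    x ^ (2 ℕ.^ (3 ℕ.* m))       ∎
    where
    open ≡-Reasoning
    q = 2 ℕ.^ m

  -- Here a = D₃(x), so D_n(a) = D_{3n}(x), and q is one of the neighbours p = 3n - 1 and 2 + p = 3n
  -- + 1. The element x will be a root in K and also the class of X in the cubic algebra; as the
  -- ring may have nilpotents, the final statements are about squares.
  module CubicFrobenius
    (x a : C) (x³+x≡a : x ^ 3 + x ≡ a) (m n p : ℕ)
    (3n≡1+p : n ℕ.* 3 ≡ suc p) (q-split : 2 ℕ.^ m ≡ p ⊎ 2 ℕ.^ m ≡ 2 ℕ.+ p)
    where

    private
      q = 2 ℕ.^ m
      D = λ j → dickson j x
      y = x ^ q
      z = y ^ q

    dickson-3n : D (suc p) ≡ dickson n a
    dickson-3n = begin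
      D (suc p)             ≡⟨ cong D 3n≡1+p ⟨
      D (n ℕ.* 3)           ≡⟨ dickson-∘ n 3 x ⟨
      dickson n (D 3)       ≡⟨ cong (dickson n) (trans (dickson-3 x) x³+x≡a) ⟩
      dickson n a           ∎
      where open ≡-Reasoning

    private
      neighbours-sum : D (2 ℕ.+ p) + D p ≡ x * dickson n a
      neighbours-sum = trans (dickson-sum 1 p x) (trans (*-comm _ _) (cong (x *_) dickson-3n))

      neighbours-product : D (2 ℕ.+ p) * D p ≡ dickson n a * dickson n a + x * x
      neighbours-product = trans (dickson-product 1 p x) (cong (λ e → e * e + x * x) dickson-3n)

      square-from-symmetric : ∀ u v s t → u + v ≡ s → u * v ≡ t → u * u + s * u + t ≡ 0#
      square-from-symmetric u v _ _ refl refl =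
        solve 2 (λ u v → u :* u :+ (u :+ v) :* u :+ u :* v := :0) refl u v

    -- D_{3n+1}(x) and D_{3n-1}(x) are the roots of one quadratic with coefficients xδ and δ² + x²,
    -- where δ = D_n(a), and x^q is one of the two. For δ = 1 the quadratic is (Y³ + Y + a)/(Y + x),
    -- so x^q is then another root of the cubic.
    frobenius-quadratic : y * y + x * dickson n a * y + (dickson n a * dickson n a + x * x) ≡ 0#
    frobenius-quadratic = [_,_]′ (λ q≡p → subst (λ e → e * e + x * dickson n a * e + (dickson n a * dickson n a + x * x) ≡ 0#)
                       (trans (cong D (sym q≡p)) (dickson-2^ m x))
                       (square-from-symmetric _ _ _ _ (trans (+-comm _ _) neighbours-sum)
                           (trans (*-comm _ _) neighbours-product)))
                       (λ q≡2+p → subst (λ e → e * e + x * dickson n a * e + (dickson n a * dickson n a + x * x) ≡ 0#)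
                       (trans (cong D (sym q≡2+p)) (dickson-2^ m x))
                       (square-from-symmetric _ _ _ _ neighbours-sum neighbours-product)) q-split

    frobenius-δ≡0 : dickson n a ≡ 0# → y * y ≡ x * x
    frobenius-δ≡0 δ≡0 = +≡0⇒≡ (trans
      (solve 2 (λ x y → y :* y :+ x :* x := y :* y :+ x :* :0 :* y :+ (:0 :* :0 :+ x :* x)) refl x y)
      (subst (λ δ → y * y + x * δ * y + (δ * δ + x * x) ≡ 0#) δ≡0 frobenius-quadratic))

    frobenius-δ≡1 : dickson n a ≡ 1# → y * y + x * y + x * x + 1# ≡ 0#
    frobenius-δ≡1 δ≡1 = trans
      (solve 2 (λ x y → y :* y :+ x :* y :+ x :* x :+ :1 := y :* y :+ x :* :1 :* y :+ (:1 :* :1 :+ x :* x)) refl x y)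
      (subst (λ δ → y * y + x * δ * y + (δ * δ + x * x) ≡ 0#) δ≡1 frobenius-quadratic)

    private
      -- If x = u + 1/u in a field, D_{k+i}(x) = 0 means u^(k+i) = 1, so that indices count modulo k
      -- + i and up to sign. In a ring the comparison of D_i with D_k survives only for squares, in
      -- `squares-agree′`.
      squares-agree : ∀ k i → D (k ℕ.+ i) ≡ 0# → D (k ℕ.+ (k ℕ.+ i)) ≡ D i
      squares-agree k i eq = +≡0⇒≡ (trans (dickson-sum k i x) (trans (cong (_* D k) eq) (zeroˡ _)))

      squares-agree′ : ∀ k i → D (k ℕ.+ i) ≡ 0# → D i * D i ≡ D k * D k
      squares-agree′ k i eq = begin
        D i * D i                          ≡⟨ cong (_* D i) (squares-agree k i eq) ⟨
        D (k ℕ.+ (k ℕ.+ i)) * D i          ≡⟨ dickson-product k i x ⟩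
        D (k ℕ.+ i) * D (k ℕ.+ i) + D k * D k  ≡⟨ cong (λ e → e * e + D k * D k) eq ⟩
        0# * 0# + D k * D k                ≡⟨ solve 1 (λ e → :0 :* :0 :+ e := e) refl _ ⟩
        D k * D k                          ∎
        where open ≡-Reasoning

      z≡D : z ≡ D (q ℕ.* q)
      z≡D = begin
        y ^ q                   ≡⟨ dickson-2^ m y ⟨
        dickson q y             ≡⟨ cong (dickson q) (dickson-2^ m x) ⟨
        dickson q (D q)         ≡⟨ dickson-∘ q q x ⟩
        D (q ℕ.* q)             ∎
        where open ≡-Reasoning

      -- With k = 2t + 1 these say that (1 + t)² and i are t² + k and t² − k.
      indices : ∀ n p → n ℕ.* 3 ≡ suc p → let t = suc p ; k = t ℕ.+ (t ℕ.+ 1) in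
        ∃ λ i → (k ℕ.+ i ≡ t ℕ.* t) × ((1 ℕ.+ t) ℕ.* (1 ℕ.+ t) ≡ k ℕ.+ (k ℕ.+ i))
      indices (suc n) _ refl = s ℕ.* s ℕ.+ 4 ℕ.* s ℕ.+ 2
        , ℕsolve 1 (λ s → k s ⊕ i s ⊜ (κ 3 ⊕ s) ⊗ (κ 3 ⊕ s)) refl s
        , ℕsolve 1 (λ s → (κ 4 ⊕ s) ⊗ (κ 4 ⊕ s) ⊜ k s ⊕ (k s ⊕ i s)) refl s
        where
        s = n ℕ.* 3
        k i : ∀ {j} → ℕPolynomial j → ℕPolynomial j
        k s = (κ 3 ⊕ s) ⊕ ((κ 3 ⊕ s) ⊕ κ 1)
        i s = s ⊗ s ⊕ κ 4 ⊗ s ⊕ κ 2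

    -- Put t = 3n. Then D_t(x) = 1, and D_{t²}(x) = D_t(1) = 0 because D₃(1) = 0. Since q and t
    -- differ by 1, q² and t² differ by k = q + t, and D_k + D_1 = D_q D_t = y gives D_k = x + y.
    -- Reflecting the index q² at t² leads to k.
    frobenius² : dickson n a ≡ 1# → z * z ≡ (x + y) * (x + y)
    frobenius² δ≡1 = go q-split
      where
      open ≡-Reasoning
      t = suc p
      Dt≡1 : D t ≡ 1#
      Dt≡1 = trans dickson-3n δ≡1
      Dtt≡0 : D (t ℕ.* t) ≡ 0#
      Dtt≡0 = begin
        D (t ℕ.* t)               ≡⟨ dickson-∘ t t x ⟨
        dickson t (D t)           ≡⟨ cong (dickson t) Dt≡1 ⟩
        dickson t 1#              ≡⟨ cong (λ j → dickson j 1#) 3n≡1+p ⟨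
        dickson (n ℕ.* 3) 1#      ≡⟨ dickson-∘ n 3 1# ⟨
        dickson n (dickson 3 1#)  ≡⟨ cong (dickson n) (solve 0 (:1 :* (:1 :* :1 :+ :0) :+ :1 := :0) refl) ⟩
        dickson n 0#              ≡⟨ dickson-0 n ⟩
        0#                        ∎
      conclude : ∀ k → z * z ≡ D k * D k → D k + x ≡ y → z * z ≡ (x + y) * (x + y)
      conclude k zz≡ eq = trans zz≡ (cong (λ e → e * e) (trans
        (solve 2 (λ x d → d := x :+ (d :+ x)) refl x (D k)) (cong (x +_) eq)))
      Dq≡y : ∀ j → q ≡ j → D j ≡ y
      Dq≡y _ refl = dickson-2^ m x
      go : q ≡ p ⊎ q ≡ 2 ℕ.+ p → z * z ≡ (x + y) * (x + y)
      go (inj₁ q≡p) = conclude (p ℕ.+ (p ℕ.+ 1))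
        (begin
          z * z                        ≡⟨ cong (λ e → e * e) (trans z≡D (cong (λ j → D (j ℕ.* j)) q≡p)) ⟩
          D (p ℕ.* p) * D (p ℕ.* p)    ≡⟨ squares-agree′ (p ℕ.+ (p ℕ.+ 1)) (p ℕ.* p)
              (trans (cong D (ℕsolve 1 (λ p → p ⊕ (p ⊕ κ 1) ⊕ p ⊗ p ⊜ (κ 1 ⊕ p) ⊗ (κ 1 ⊕ p)) refl p)) Dtt≡0) ⟩
          _                            ∎)
        (begin
          D (p ℕ.+ (p ℕ.+ 1)) + x      ≡⟨ dickson-sum p 1 x ⟩
          D (p ℕ.+ 1) * D p            ≡⟨ cong₂ (λ j e → D j * e) (ℕₚ.+-comm p 1) (Dq≡y p q≡p) ⟩
          D t * y                      ≡⟨ cong (_* y) Dt≡1 ⟩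
          1# * y                       ≡⟨ *-identityˡ y ⟩
          y                            ∎)
      go (inj₂ q≡2+p) with indices n p 3n≡1+p
      ... | i , ix₁ , ix₂ = conclude (t ℕ.+ (t ℕ.+ 1))
        (begin
          z * z                        ≡⟨ cong (λ e → e * e) (trans z≡D (cong (λ j → D (j ℕ.* j)) q≡2+p)) ⟩
          D ((1 ℕ.+ t) ℕ.* (1 ℕ.+ t)) * D ((1 ℕ.+ t) ℕ.* (1 ℕ.+ t))
            ≡⟨ cong (λ e → e * e) (trans (cong D ix₂) (squares-agree (t ℕ.+ (t ℕ.+ 1)) i
                (trans (cong D ix₁) Dtt≡0))) ⟩
          D i * D i                    ≡⟨ squares-agree′ (t ℕ.+ (t ℕ.+ 1)) i (trans (cong D ix₁) Dtt≡0) ⟩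
          _                            ∎)
        (begin
          D (t ℕ.+ (t ℕ.+ 1)) + x      ≡⟨ dickson-sum t 1 x ⟩
          D (t ℕ.+ 1) * D t            ≡⟨ cong₂ (λ j e → D j * e) (ℕₚ.+-comm t 1) Dt≡1 ⟩
          D (1 ℕ.+ t) * 1#             ≡⟨ *-identityʳ _ ⟩
          D (1 ℕ.+ t)                  ≡⟨ Dq≡y (1 ℕ.+ t) q≡2+p ⟩
          y                            ∎)

-- The algebra of the cubic X³ + X + a

module CubicAlgebra (R : CharTwoRing) (a : CharTwoRing.Carrier R) where
  open CharTwoRing R renaming (Carrier to C)
  open CharTwoTheory R

  -- C[X]/(X³ + X + a), with basis 1, X, X².
  A : Set
  A = C × C × C

  triple : ∀ {x y z x′ y′ z′ : C} → x ≡ x′ → y ≡ y′ → z ≡ z′ → (x , y , z) ≡ (x′ , y′ , z′)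
  triple refl refl refl = refl

  infixl 6 _⊞_
  infixl 7 _⊠_

  _⊞_ _⊠_ : A → A → A
  (p₀ , p₁ , p₂) ⊞ (q₀ , q₁ , q₂) = p₀ + q₀ , p₁ + q₁ , p₂ + q₂
  (p₀ , p₁ , p₂) ⊠ (q₀ , q₁ , q₂) =
      p₀ * q₀ + a * (p₁ * q₂ + p₂ * q₁)
    , p₀ * q₁ + p₁ * q₀ + (p₁ * q₂ + p₂ * q₁) + a * (p₂ * q₂)
    , p₀ * q₂ + p₁ * q₁ + p₂ * q₀ + p₂ * q₂

  0ₐ 1ₐ X : A
  0ₐ = 0# , 0# , 0#
  1ₐ = 1# , 0# , 0#
  X  = 0# , 1# , 0#

  private
    infixl 6 _:⊞_

    Coords : ℕ → Set
    Coords n = Polynomial n × Polynomial n × Polynomial n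

    _:⊞_ : ∀ {n} → Coords n → Coords n → Coords n
    (p₀ , p₁ , p₂) :⊞ (q₀ , q₁ , q₂) = p₀ :+ q₀ , p₁ :+ q₁ , p₂ :+ q₂

    multiply : ∀ {n} → Polynomial n → Coords n → Coords n → Coords n
    multiply a (p₀ , p₁ , p₂) (q₀ , q₁ , q₂) =
        p₀ :* q₀ :+ a :* (p₁ :* q₂ :+ p₂ :* q₁)
      , p₀ :* q₁ :+ p₁ :* q₀ :+ (p₁ :* q₂ :+ p₂ :* q₁) :+ a :* (p₂ :* q₂)
      , p₀ :* q₂ :+ p₁ :* q₁ :+ p₂ :* q₀ :+ p₂ :* q₂

    module Associativity {n} (a p₀ p₁ p₂ q₀ q₁ q₂ r₀ r₁ r₂ : Polynomial n) where
      _:⊠_ = multiply a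
      p = p₀ , p₁ , p₂
      q = q₀ , q₁ , q₂
      r = r₀ , r₁ , r₂
      lhs = (p :⊠ q) :⊠ r
      rhs = p :⊠ (q :⊠ r)

    module Distributivity {n} (a p₀ p₁ p₂ q₀ q₁ q₂ r₀ r₁ r₂ : Polynomial n) where
      _:⊠_ = multiply a
      p = p₀ , p₁ , p₂
      q = q₀ , q₁ , q₂
      r = r₀ , r₁ , r₂
      lhs = p :⊠ (q :⊞ r)
      rhs = (p :⊠ q) :⊞ (p :⊠ r)

    module Commutativity {n} (a p₀ p₁ p₂ q₀ q₁ q₂ : Polynomial n) where
      p = p₀ , p₁ , p₂
      q = q₀ , q₁ , q₂
      lhs = multiply a p q
      rhs = multiply a q p

  ⊠-assoc : ∀ p q r → (p ⊠ q) ⊠ r ≡ p ⊠ (q ⊠ r)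
  ⊠-assoc (p₀ , p₁ , p₂) (q₀ , q₁ , q₂) (r₀ , r₁ , r₂) = triple
    (solve 10 (λ a p₀ p₁ p₂ q₀ q₁ q₂ r₀ r₁ r₂ → let open Associativity a p₀ p₁ p₂ q₀ q₁ q₂ r₀ r₁ r₂ in
      proj₁ lhs := proj₁ rhs) refl a p₀ p₁ p₂ q₀ q₁ q₂ r₀ r₁ r₂)
    (solve 10 (λ a p₀ p₁ p₂ q₀ q₁ q₂ r₀ r₁ r₂ → let open Associativity a p₀ p₁ p₂ q₀ q₁ q₂ r₀ r₁ r₂ in
      proj₁ (proj₂ lhs) := proj₁ (proj₂ rhs)) refl a p₀ p₁ p₂ q₀ q₁ q₂ r₀ r₁ r₂)
    (solve 10 (λ a p₀ p₁ p₂ q₀ q₁ q₂ r₀ r₁ r₂ → let open Associativity a p₀ p₁ p₂ q₀ q₁ q₂ r₀ r₁ r₂ in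
      proj₂ (proj₂ lhs) := proj₂ (proj₂ rhs)) refl a p₀ p₁ p₂ q₀ q₁ q₂ r₀ r₁ r₂)

  ⊠-comm : ∀ p q → p ⊠ q ≡ q ⊠ p
  ⊠-comm (p₀ , p₁ , p₂) (q₀ , q₁ , q₂) = triple
    (solve 7 (λ a p₀ p₁ p₂ q₀ q₁ q₂ → let open Commutativity a p₀ p₁ p₂ q₀ q₁ q₂ in
      proj₁ lhs := proj₁ rhs) refl a p₀ p₁ p₂ q₀ q₁ q₂)
    (solve 7 (λ a p₀ p₁ p₂ q₀ q₁ q₂ → let open Commutativity a p₀ p₁ p₂ q₀ q₁ q₂ in
      proj₁ (proj₂ lhs) := proj₁ (proj₂ rhs)) refl a p₀ p₁ p₂ q₀ q₁ q₂)
    (solve 7 (λ a p₀ p₁ p₂ q₀ q₁ q₂ → let open Commutativity a p₀ p₁ p₂ q₀ q₁ q₂ in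
      proj₂ (proj₂ lhs) := proj₂ (proj₂ rhs)) refl a p₀ p₁ p₂ q₀ q₁ q₂)

  ⊠-distribˡ-⊞ : ∀ p q r → p ⊠ (q ⊞ r) ≡ (p ⊠ q) ⊞ (p ⊠ r)
  ⊠-distribˡ-⊞ (p₀ , p₁ , p₂) (q₀ , q₁ , q₂) (r₀ , r₁ , r₂) = triple
    (solve 10 (λ a p₀ p₁ p₂ q₀ q₁ q₂ r₀ r₁ r₂ → let open Distributivity a p₀ p₁ p₂ q₀ q₁ q₂ r₀ r₁ r₂ in
      proj₁ lhs := proj₁ rhs) refl a p₀ p₁ p₂ q₀ q₁ q₂ r₀ r₁ r₂)
    (solve 10 (λ a p₀ p₁ p₂ q₀ q₁ q₂ r₀ r₁ r₂ → let open Distributivity a p₀ p₁ p₂ q₀ q₁ q₂ r₀ r₁ r₂ in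
      proj₁ (proj₂ lhs) := proj₁ (proj₂ rhs)) refl a p₀ p₁ p₂ q₀ q₁ q₂ r₀ r₁ r₂)
    (solve 10 (λ a p₀ p₁ p₂ q₀ q₁ q₂ r₀ r₁ r₂ → let open Distributivity a p₀ p₁ p₂ q₀ q₁ q₂ r₀ r₁ r₂ in
      proj₂ (proj₂ lhs) := proj₂ (proj₂ rhs)) refl a p₀ p₁ p₂ q₀ q₁ q₂ r₀ r₁ r₂)

  ⊠-identityˡ : ∀ p → 1ₐ ⊠ p ≡ p
  ⊠-identityˡ (p₀ , p₁ , p₂) = triple
    (solve 4 (λ a p₀ p₁ p₂ → proj₁ (multiply a (:1 , :0 , :0) (p₀ , p₁ , p₂)) := p₀) refl a p₀ p₁ p₂)
    (solve 4 (λ a p₀ p₁ p₂ → proj₁ (proj₂ (multiply a (:1 , :0 , :0) (p₀ , p₁ , p₂))) := p₁) refl a p₀ p₁ p₂)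
    (solve 4 (λ a p₀ p₁ p₂ → proj₂ (proj₂ (multiply a (:1 , :0 , :0) (p₀ , p₁ , p₂))) := p₂) refl a p₀ p₁ p₂)

  cubicRing : CharTwoRing
  cubicRing = record
    { Carrier = A ; _+_ = _⊞_ ; _*_ = _⊠_ ; -_ = λ p → p ; 0# = 0ₐ ; 1# = 1ₐ
    ; isCommutativeRing = record
      { isRing = record
        { +-isAbelianGroup = record
          { isGroup = record
            { isMonoid = record
              { isSemigroup = record
                { isMagma = record { isEquivalence = isEquivalence ; ∙-cong = cong₂ _⊞_ }
                ; assoc   = λ (p₀ , p₁ , p₂) (q₀ , q₁ , q₂) (r₀ , r₁ , r₂) →
                    triple (+-assoc p₀ q₀ r₀) (+-assoc p₁ q₁ r₁) (+-assoc p₂ q₂ r₂)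
                }
              ; identity = (λ (p₀ , p₁ , p₂) → triple (+-identityˡ p₀) (+-identityˡ p₁) (+-identityˡ p₂))
                         , (λ (p₀ , p₁ , p₂) → triple (+-identityʳ p₀) (+-identityʳ p₁) (+-identityʳ p₂))
              }
            ; inverse = p⊞p≡0 , p⊞p≡0
            ; ⁻¹-cong = λ eq → eq
            }
          ; comm = λ (p₀ , p₁ , p₂) (q₀ , q₁ , q₂) → triple (+-comm p₀ q₀) (+-comm p₁ q₁) (+-comm p₂ q₂)
          }
        ; *-cong     = cong₂ _⊠_
        ; *-assoc    = ⊠-assoc
        ; *-identity = ⊠-identityˡ , (λ p → trans (⊠-comm p 1ₐ) (⊠-identityˡ p))
        ; distrib    = ⊠-distribˡ-⊞
                     , (λ p q r → trans (⊠-comm (q ⊞ r) p)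
                         (trans (⊠-distribˡ-⊞ p q r) (cong₂ _⊞_ (⊠-comm p q) (⊠-comm p r))))
        }
      ; *-comm = ⊠-comm
      }
    ; 1+1≡0 = p⊞p≡0 1ₐ
    }
    where
    p⊞p≡0 : ∀ p → p ⊞ p ≡ 0ₐ
    p⊞p≡0 (p₀ , p₁ , p₂) = triple (double p₀) (double p₁) (double p₂)

  private module 𝔸 = CharTwoTheory cubicRing

  X³+X≡a : X 𝔸.^ 3 ⊞ X ≡ (a , 0# , 0#)
  X³+X≡a = triple
    (solve 1 (λ a → let _:⊠_ = multiply a ; X = :0 , :1 , :0 in
      proj₁ (X :⊠ (X :⊠ (X :⊠ (:1 , :0 , :0))) :⊞ X) := a) refl a)
    (solve 1 (λ a → let _:⊠_ = multiply a ; X = :0 , :1 , :0 in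
      proj₁ (proj₂ (X :⊠ (X :⊠ (X :⊠ (:1 , :0 , :0))) :⊞ X)) := :0) refl a)
    (solve 1 (λ a → let _:⊠_ = multiply a ; X = :0 , :1 , :0 in
      proj₂ (proj₂ (X :⊠ (X :⊠ (X :⊠ (:1 , :0 , :0))) :⊞ X)) := :0) refl a)

  constant : C → A
  constant c = c , 0# , 0#

  constant-+ : ∀ c d → constant (c + d) ≡ constant c ⊞ constant d
  constant-+ c d = triple refl (sym (+-identityˡ 0#)) (sym (+-identityˡ 0#))

  constant-* : ∀ c d → constant (c * d) ≡ constant c ⊠ constant d
  constant-* c d = triple
    (solve 3 (λ a c d → c :* d := proj₁ (multiply a (c , :0 , :0) (d , :0 , :0))) refl a c d)
    (solve 3 (λ a c d → :0 := proj₁ (proj₂ (multiply a (c , :0 , :0) (d , :0 , :0)))) refl a c d)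
    (solve 3 (λ a c d → :0 := proj₂ (proj₂ (multiply a (c , :0 , :0) (d , :0 , :0)))) refl a c d)

  dickson-constant : ∀ k c → 𝔸.dickson k (constant c) ≡ constant (dickson k c)
  dickson-constant zero          c = refl
  dickson-constant (suc zero)    c = refl
  dickson-constant (suc (suc k)) c = begin
    constant c ⊠ 𝔸.dickson (suc k) (constant c) ⊞ 𝔸.dickson k (constant c)
      ≡⟨ cong₂ (λ p q → constant c ⊠ p ⊞ q) (dickson-constant (suc k) c) (dickson-constant k c) ⟩
    constant c ⊠ constant (dickson (suc k) c) ⊞ constant (dickson k c)
      ≡⟨ cong (_⊞ constant (dickson k c)) (constant-* c (dickson (suc k) c)) ⟨
    constant (c * dickson (suc k) c) ⊞ constant (dickson k c)
      ≡⟨ constant-+ (c * dickson (suc k) c) (dickson k c) ⟨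
    constant (dickson (suc (suc k)) c) ∎
    where open ≡-Reasoning

  -- Squaring is additive and X⁴ = X² + aX. The formula serves to show that squaring is injective
  -- when a ≠ 0.
  square-coordinates : ∀ p₀ p₁ p₂ → (p₀ , p₁ , p₂) ⊠ (p₀ , p₁ , p₂) ≡ (p₀ * p₀ , a * (p₂ * p₂) , p₁ * p₁ + p₂ * p₂)
  square-coordinates p₀ p₁ p₂ = triple
    (solve 4 (λ a p₀ p₁ p₂ → proj₁ (multiply a (p₀ , p₁ , p₂) (p₀ , p₁ , p₂)) := p₀ :* p₀) refl a p₀ p₁ p₂)
    (solve 4 (λ a p₀ p₁ p₂ → proj₁ (proj₂ (multiply a (p₀ , p₁ , p₂) (p₀ , p₁ , p₂))) := a :* (p₂ :* p₂))
        refl a p₀ p₁ p₂)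
    (solve 4 (λ a p₀ p₁ p₂ → proj₂ (proj₂ (multiply a (p₀ , p₁ , p₂) (p₀ , p₁ , p₂))) := p₁ :* p₁ :+ p₂ :* p₂)
        refl a p₀ p₁ p₂)

  evaluate : C → A → C
  evaluate r (p₀ , p₁ , p₂) = p₀ + p₁ * r + p₂ * (r * r)

  leading : A → C
  leading (_ , _ , p₂) = p₂

  -- Evaluation takes place at arbitrary r, so it respects multiplication by X only up to a multiple
  -- of the cubic. The multiplier is the next coefficient of the quotient in a long division.
  evaluate-X⊠ : ∀ r p → r * evaluate r p ≡ evaluate r (X ⊠ p) + leading p * (r ^ 3 + r + a)
  evaluate-X⊠ r (p₀ , p₁ , p₂) =
    solve 5 (λ a r p₀ p₁ p₂ →
      let s = multiply a (:0 , :1 , :0) (p₀ , p₁ , p₂)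
          ev = λ ((p₀ , p₁ , p₂) : Coords 5) → p₀ :+ p₁ :* r :+ p₂ :* (r :* r)
      in r :* ev (p₀ , p₁ , p₂) := ev s :+ p₂ :* (r :^ 3 :+ r :+ a)) refl a r p₀ p₁ p₂

-- Finite fields: Fermat's theorem and roots of polynomials

sameElements⇒↭ : ∀ {A : Set} {xs ys : List A} → Unique xs → Unique ys →
  (∀ x → x ∈ xs → x ∈ ys) → (∀ x → x ∈ ys → x ∈ xs) → xs ↭ ys
sameElements⇒↭ xs! ys! ⊆ ⊇ = ∼bag⇒↭ (unique∧set⇒bag xs! ys! (λ {x} → mk⇔ (⊆ x) (⊇ x)))

module FiniteField {e : ℕ} (K : GF2Field e) where
  open GF2Field K hiding (dickson) renaming (Carrier to C)

  charTwoRing : CharTwoRing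
  charTwoRing = record { isCommutativeRing = isCommutativeRing ; 1+1≡0 = char2 }

  open CharTwoTheory charTwoRing public

  x*y≡0 : ∀ {x y} → x * y ≡ 0# → x ≢ 0# → y ≡ 0#
  x*y≡0 {x} {y} xy≡0 x≢0 = begin
    y               ≡⟨ *-identityʳ y ⟨
    y * 1#          ≡⟨ cong (y *_) (inverseʳ x x≢0) ⟨
    y * (x * x ⁻¹)  ≡⟨ solve 3 (λ x y z → y :* (x :* z) := (x :* y) :* z) refl x y (x ⁻¹) ⟩
    (x * y) * x ⁻¹  ≡⟨ cong (_* x ⁻¹) xy≡0 ⟩
    0# * x ⁻¹       ≡⟨ zeroˡ _ ⟩
    0#              ∎
    where open ≡-Reasoning

  *-≢0 : ∀ {x y} → x ≢ 0# → y ≢ 0# → x * y ≢ 0#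
  *-≢0 x≢0 y≢0 xy≡0 = y≢0 (x*y≡0 xy≡0 x≢0)

  *-cancelˡ : ∀ {x y z} → x ≢ 0# → x * y ≡ x * z → y ≡ z
  *-cancelˡ {x} {y} {z} x≢0 eq = +≡0⇒≡ (x*y≡0 (trans (distribˡ x y z) (≡⇒+≡0 eq)) x≢0)

  x*x≡0 : ∀ {x} → x * x ≡ 0# → x ≡ 0#
  x*x≡0 {x} xx≡0 with x ≟ 0#
  ... | yes x≡0 = x≡0
  ... | no  x≢0 = x*y≡0 xx≡0 x≢0

  square-injective : ∀ {x y} → x * x ≡ y * y → x ≡ y
  square-injective {x} {y} eq = +≡0⇒≡ (x*x≡0 (trans
    (solve 2 (λ x y → (x :+ y) :* (x :+ y) := x :* x :+ y :* y) refl x y) (≡⇒+≡0 eq)))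

  pow≡^ : ∀ x n → pow x n ≡ x ^ n
  pow≡^ x zero    = refl
  pow≡^ x (suc n) = cong (x *_) (pow≡^ x n)

  dickson≡ : ∀ k x → GF2Field.dickson K k x ≡ dickson k x
  dickson≡ zero          x = char2
  dickson≡ (suc zero)    x = refl
  dickson≡ (suc (suc k)) x = cong₂ (λ u v → x * u + v) (dickson≡ (suc k) x) (trans (neg≡id _) (dickson≡ k x))

  ^-≢0 : ∀ {x} n → x ≢ 0# → x ^ n ≢ 0#
  ^-≢0 zero    x≢0 1≡0 = 0≢1 (sym 1≡0)
  ^-≢0 (suc n) x≢0     = *-≢0 x≢0 (^-≢0 n x≢0)

  elements-unique : Unique elements
  elements-unique = Unique.map⁺ to-injective (Unique.allFin⁺ (2 ℕ.^ e))
    where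
    to-injective : ∀ {i j} → Inverse.to enum i ≡ Inverse.to enum j → i ≡ j
    to-injective {i} {j} eq = trans (sym (Inverse.strictlyInverseʳ enum i))
      (trans (cong (Inverse.from enum) eq) (Inverse.strictlyInverseʳ enum j))

  ∈-elements : ∀ x → x ∈ elements
  ∈-elements x = subst (_∈ elements) (Inverse.strictlyInverseˡ enum x)
    (∈-map⁺ (Inverse.to enum) (∈-allFin (Inverse.from enum x)))

  length-elements : length elements ≡ 2 ℕ.^ e
  length-elements = trans (length-map (Inverse.to enum) (allFin (2 ℕ.^ e))) (length-tabulate {n = 2 ℕ.^ e} id)

  numRoots≡length : ∀ f roots → Unique roots → (∀ x → x ∈ roots → f x ≡ 0#) → (∀ x → f x ≡ 0# → x ∈ roots) →
    numRoots f ≡ length roots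
  numRoots≡length f roots roots! sound complete = ↭-length (sameElements⇒↭
    (Unique.filter⁺ (λ x → f x ≟ 0#) elements-unique) roots!
    (λ x x∈ → complete x (proj₂ (∈-filter⁻ (λ x → f x ≟ 0#) {xs = elements} x∈)))
    (λ x x∈ → ∈-filter⁺ (λ x → f x ≟ 0#) (∈-elements x) (sound x x∈)))

  numRoots-cong : ∀ {f g} → (∀ x → f x ≡ g x) → numRoots f ≡ numRoots g
  numRoots-cong {f} {g} f≗g = numRoots≡length f (filter (λ x → g x ≟ 0#) elements)
    (Unique.filter⁺ (λ x → g x ≟ 0#) elements-unique)
    (λ x x∈ → trans (f≗g x) (proj₂ (∈-filter⁻ (λ x → g x ≟ 0#) {xs = elements} x∈)))
    (λ x fx≡0 → ∈-filter⁺ (λ x → g x ≟ 0#) (∈-elements x) (trans (sym (f≗g x)) fx≡0))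

  private
    product : List C → C
    product = foldr _*_ 1#

    product-map : ∀ x ys → product (map (x *_) ys) ≡ x ^ length ys * product ys
    product-map x []       = sym (*-identityˡ 1#)
    product-map x (y ∷ ys) = begin
      x * y * product (map (x *_) ys)           ≡⟨ cong (x * y *_) (product-map x ys) ⟩
      x * y * (x ^ length ys * product ys)
        ≡⟨ solve 4 (λ x y u v → x :* y :* (u :* v) := x :* u :* (y :* v)) refl x y (x ^ length ys) (product ys) ⟩
      x ^ length (y ∷ ys) * product (y ∷ ys)    ∎
      where open ≡-Reasoning

    product-≢0 : ∀ {ys} → All (_≢ 0#) ys → product ys ≢ 0#
    product-≢0 []           1≡0 = 0≢1 (sym 1≡0)
    product-≢0 (y≢0 ∷ ys≢0)     = *-≢0 y≢0 (product-≢0 ys≢0)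

    product-↭ : ∀ {xs ys} → xs ↭ ys → product xs ≡ product ys
    product-↭ xs↭ys = Permutationₛ.foldr-commMonoid (setoid C)
      (CommutativeRing.*-isCommutativeMonoid ring) (↭⇒↭ₛ xs↭ys)

    nonzero? : ∀ x → Dec (x ≢ 0#)
    nonzero? x = ¬? (x ≟ 0#)

    nonzeros : List C
    nonzeros = filter nonzero? elements

    ∈-nonzeros : ∀ {x} → x ≢ 0# → x ∈ nonzeros
    ∈-nonzeros x≢0 = ∈-filter⁺ nonzero? (∈-elements _) x≢0

    nonzeros-≢0 : ∀ {x} → x ∈ nonzeros → x ≢ 0#
    nonzeros-≢0 x∈ = proj₂ (∈-filter⁻ nonzero? {xs = elements} x∈)

    nonzeros-unique : Unique nonzeros
    nonzeros-unique = Unique.filter⁺ nonzero? elements-unique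

    0∷nonzeros↭elements : 0# ∷ nonzeros ↭ elements
    0∷nonzeros↭elements = sameElements⇒↭
      (All.tabulate (λ x∈ 0≡x → nonzeros-≢0 x∈ (sym 0≡x)) ∷ nonzeros-unique) elements-unique
      (λ x _ → ∈-elements x) λ x _ → back x
      where
      back : ∀ x → x ∈ 0# ∷ nonzeros
      back x with x ≟ 0#
      ... | yes x≡0 = here x≡0
      ... | no  x≢0 = there (∈-nonzeros x≢0)

    1+length-nonzeros : suc (length nonzeros) ≡ 2 ℕ.^ e
    1+length-nonzeros = trans (↭-length 0∷nonzeros↭elements) length-elements

    scaled-nonzeros : ∀ {x} → x ≢ 0# → map (x *_) nonzeros ↭ nonzeros
    scaled-nonzeros {x} x≢0 = sameElements⇒↭
      (Unique.map⁺ (*-cancelˡ x≢0) nonzeros-unique) nonzeros-unique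
      (λ z z∈ → let y , y∈ , z≡xy = ∈-map⁻ (x *_) z∈ in
        ∈-nonzeros (λ z≡0 → *-≢0 x≢0 (nonzeros-≢0 y∈) (trans (sym z≡xy) z≡0)))
      (λ z z∈ → subst (_∈ map (x *_) nonzeros) (x*x⁻¹z z)
        (∈-map⁺ (x *_) (∈-nonzeros (λ x⁻¹z≡0 → nonzeros-≢0 z∈
            (trans (sym (x*x⁻¹z z)) (trans (cong (x *_) x⁻¹z≡0) (zeroʳ x)))))))
      where
      x*x⁻¹z : ∀ z → x * (x ⁻¹ * z) ≡ z
      x*x⁻¹z z = trans (sym (*-assoc x (x ⁻¹) z)) (trans (cong (_* z) (inverseʳ x x≢0)) (*-identityˡ z))

  -- Multiplication by x permutes the nonzero elements, so their product P satisfies x^j P = P and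
  -- can be cancelled.
  nonzero-order : ∀ {x} j → suc j ≡ 2 ℕ.^ e → x ≢ 0# → x ^ j ≡ 1#
  nonzero-order {x} j 1+j≡ x≢0 = *-cancelˡ (product-≢0 {nonzeros} (All.tabulate nonzeros-≢0)) (begin
    P * x ^ j                     ≡⟨ *-comm P _ ⟩
    x ^ j * P                     ≡⟨ cong (λ i → x ^ i * P) (ℕₚ.suc-injective (trans 1+j≡ (sym 1+length-nonzeros))) ⟩
    x ^ length nonzeros * P       ≡⟨ product-map x nonzeros ⟨
    product (map (x *_) nonzeros) ≡⟨ product-↭ (scaled-nonzeros x≢0) ⟩
    P                             ≡⟨ *-identityʳ P ⟨
    P * 1#                        ∎)
    where
    open ≡-Reasoning
    P = product nonzeros

  fermat : ∀ x → x ^ (2 ℕ.^ e) ≡ x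
  fermat x with x ≟ 0#
  ... | yes refl = subst (λ i → 0# ^ i ≡ 0#) 1+length-nonzeros (zeroˡ _)
  ... | no  x≢0  = subst (λ i → x ^ i ≡ x) 1+length-nonzeros
    (trans (cong (x *_) (nonzero-order (length nonzeros) 1+length-nonzeros x≢0)) (*-identityʳ x))

  -- The vector lists the coefficients below the leading 1, constant term first.
  monic : ∀ {d} → Vec C d → C → C
  monic []       x = 1#
  monic (c ∷ cs) x = x * monic cs x + c

  private
    -- Horner's scheme: the coefficients of the quotient by X + r are the values at r of the
    -- successive tails.
    quotient : ∀ {d} → Vec C (suc d) → C → Vec C d
    quotient (c ∷ [])      r = []
    quotient (c ∷ c′ ∷ cs) r = monic (c′ ∷ cs) r ∷ quotient (c′ ∷ cs) r

    quotient-correct : ∀ {d} (cs : Vec C (suc d)) r x → monic cs x + monic cs r ≡ (x + r) * monic (quotient cs r) x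
    quotient-correct (c ∷ []) r x =
      solve 3 (λ c r x → (x :* :1 :+ c) :+ (r :* :1 :+ c) := (x :+ r) :* :1) refl c r x
    quotient-correct (c ∷ c′ ∷ cs) r x = begin
      (x * h x + c) + (r * h r + c)
        ≡⟨ solve 5 (λ c r x u v → (x :* u :+ c) :+ (r :* v :+ c) := x :* (u :+ v) :+ (x :+ r) :* v)
            refl c r x (h x) (h r) ⟩
      x * (h x + h r) + (x + r) * h r
        ≡⟨ cong (λ t → x * t + (x + r) * h r) (quotient-correct (c′ ∷ cs) r x) ⟩
      x * ((x + r) * g) + (x + r) * h r
        ≡⟨ solve 4 (λ x r g v → x :* ((x :+ r) :* g) :+ (x :+ r) :* v := (x :+ r) :* (x :* g :+ v)) refl x r g (h r) ⟩
      (x + r) * (x * g + h r) ∎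
      where
      open ≡-Reasoning
      h = monic (c′ ∷ cs)
      g = monic (quotient (c′ ∷ cs) r) x

  monic-roots≤degree : ∀ {d} (cs : Vec C d) xs → Unique xs → All (λ x → monic cs x ≡ 0#) xs → length xs ℕ.≤ d
  monic-roots≤degree cs       []       _            _              = ℕ.z≤n
  monic-roots≤degree []       (r ∷ xs) _            (1≡0 ∷ _)      = contradiction (sym 1≡0) 0≢1
  monic-roots≤degree (c ∷ cs) (r ∷ xs) (r∉xs ∷ xs!) (r-root ∷ roots) =
    ℕ.s≤s (monic-roots≤degree (quotient (c ∷ cs) r) xs xs! (All.zipWith root (r∉xs , roots)))
    where
    root : ∀ {x} → r ≢ x × monic (c ∷ cs) x ≡ 0# → monic (quotient (c ∷ cs) r) x ≡ 0#
    root {x} (r≢x , x-root) = x*y≡0 (trans (sym (quotient-correct (c ∷ cs) r x))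
      (trans (cong₂ _+_ x-root r-root) (+-identityˡ 0#))) (λ x+r≡0 → r≢x (sym (+≡0⇒≡ x+r≡0)))

  -- Both existence claims about K, a generator of 𝔽₈ and two roots of the cubic, come from this
  -- counting argument.
  monic-nonroot : ∀ {d} (cs : Vec C d) → d ℕ.< 2 ℕ.^ e → ∃ λ x → monic cs x ≢ 0#
  monic-nonroot cs d<|K| with All.all? (λ x → monic cs x ≟ 0#) elements
  ... | yes roots  = contradiction (monic-roots≤degree cs elements elements-unique roots)
                       (ℕₚ.<⇒≱ (subst (_ ℕ.<_) (sym length-elements) d<|K|))
  ... | no  ¬roots = Any.satisfied (All.¬All⇒Any¬ (λ x → monic cs x ≟ 0#) elements ¬roots)

  addToConstant : ∀ {d} → C → Vec C (suc d) → Vec C (suc d)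
  addToConstant b (c ∷ cs) = c + b ∷ cs

  timesLinear : ∀ {d} → C → Vec C d → Vec C (suc d)
  timesLinear r []       = r ∷ []
  timesLinear r (c ∷ cs) = r * c ∷ addToConstant c (timesLinear r cs)

  monic-addToConstant : ∀ {d} b (cs : Vec C (suc d)) x → monic (addToConstant b cs) x ≡ monic cs x + b
  monic-addToConstant b (c ∷ cs) x = sym (+-assoc _ c b)

  monic-timesLinear : ∀ {d} r (cs : Vec C d) x → monic (timesLinear r cs) x ≡ (x + r) * monic cs x
  monic-timesLinear r []       x = solve 2 (λ x r → x :* :1 :+ r := (x :+ r) :* :1) refl x r
  monic-timesLinear r (c ∷ cs) x = begin
    x * monic (addToConstant c (timesLinear r cs)) x + r * c
      ≡⟨ cong (λ t → x * t + r * c) (trans (monic-addToConstant c (timesLinear r cs) x)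
          (cong (_+ c) (monic-timesLinear r cs x))) ⟩
    x * ((x + r) * monic cs x + c) + r * c
      ≡⟨ solve 4 (λ x r c h → x :* ((x :+ r) :* h :+ c) :+ r :* c := (x :+ r) :* (x :* h :+ c))
          refl x r c (monic cs x) ⟩
    (x + r) * (x * monic cs x + c) ∎
    where open ≡-Reasoning

  monic-zeros : ∀ d x → monic (replicate d 0#) x ≡ x ^ d
  monic-zeros zero    x = refl
  monic-zeros (suc d) x = trans (+-identityʳ _) (cong (x *_) (monic-zeros d x))

-- This has two uses: 7 divides |K| - 1, which provides a seventh root of unity, and |K| ≥ 8, which
-- leaves room for dividing X^|K| by the cubic.
8^-mod-7 : ∀ m → ∃ λ k → 2 ℕ.^ (3 ℕ.* suc m) ≡ suc (suc k ℕ.* 7)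
8^-mod-7 m with go m
  where
  go : ∀ m → ∃ λ k → 8 ℕ.^ suc m ≡ suc (suc k ℕ.* 7)
  go zero    = 0 , refl
  go (suc m) with go m
  ... | k , eq = 8 ℕ.* suc k , trans (cong (8 ℕ.*_) eq)
        (ℕsolve 1 (λ k → κ 8 ⊗ (κ 1 ⊕ (κ 1 ⊕ k) ⊗ κ 7) ⊜ κ 1 ⊕ (κ 1 ⊕ κ 8 ⊗ (κ 1 ⊕ k)) ⊗ κ 7) refl k)
... | k , eq = k , trans (sym (ℕₚ.^-*-assoc 2 3 (suc m))) eq

-- Partial traces and Dickson polynomials of index 2^k + 1

module Traces {e : ℕ} (K : GF2Field e) where
  open GF2Field K hiding (dickson) renaming (Carrier to C)
  open FiniteField K

  -- The residue of 2^m modulo 3 and the trace of 1 both depend only on the parity of m, so one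
  -- induction follows the two together.
  Tr-1 : ∀ m → (∃ λ k → 2 ℕ.^ suc m ≡ 1 ℕ.+ suc k ℕ.* 3 × Tr (suc m) 1# ≡ 0#)
             ⊎ (∃ λ k → 2 ℕ.^ suc m ≡ 2 ℕ.+ k ℕ.* 3 × Tr (suc m) 1# ≡ 1#)
  Tr-1 zero    = inj₂ (0 , refl , solve 0 (:0 :+ :1 :* :1 := :1) refl)
  Tr-1 (suc m) with Tr-1 m
  ... | inj₁ (k , 2^m≡ , Tr≡) = inj₂ (2 ℕ.* suc k
        , trans (cong (2 ℕ.*_) 2^m≡)
          (ℕsolve 1 (λ k → κ 2 ⊗ (κ 1 ⊕ (κ 1 ⊕ k) ⊗ κ 3) ⊜ κ 2 ⊕ (κ 2 ⊗ (κ 1 ⊕ k)) ⊗ κ 3) refl k)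
        , trans (cong₂ _+_ Tr≡ (pow-1 (2 ℕ.^ suc m))) (+-identityˡ 1#))
    where
    pow-1 : ∀ k → pow 1# k ≡ 1#
    pow-1 k = trans (pow≡^ 1# k) (1^ k)
  ... | inj₂ (k , 2^m≡ , Tr≡) = inj₁ (2 ℕ.* k
        , trans (cong (2 ℕ.*_) 2^m≡)
          (ℕsolve 1 (λ k → κ 2 ⊗ (κ 2 ⊕ k ⊗ κ 3) ⊜ κ 1 ⊕ (κ 1 ⊕ κ 2 ⊗ k) ⊗ κ 3) refl k)
        , trans (cong₂ _+_ Tr≡ (trans (pow≡^ 1# (2 ℕ.^ suc m)) (1^ (2 ℕ.^ suc m)))) char2)

  -- Squaring shifts the terms of a partial trace by one. In this form the recursion matches the
  -- passage from D_{2^k+1} to D_{2^(k+1)+1}, which also squares.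
  Tr-suc : ∀ k x → Tr (suc k) x ≡ x + Tr k x * Tr k x
  Tr-suc zero    x = solve 1 (λ x → :0 :+ x :* :1 := x :+ :0 :* :0) refl x
  Tr-suc (suc k) x = begin
    Tr (suc k) x + pow x (2 ℕ.^ suc k)
      ≡⟨ cong₂ _+_ (Tr-suc k x) (trans (pow≡^ x (2 ℕ.^ suc k)) (^-2^suc x k)) ⟩
    x + T * T + P * P
      ≡⟨ solve 3 (λ x T P → x :+ T :* T :+ P :* P := x :+ (T :+ P) :* (T :+ P)) refl x T P ⟩
    x + (T + P) * (T + P)
      ≡⟨ cong (λ t → x + (T + t) * (T + t)) (pow≡^ x (2 ℕ.^ k)) ⟨
    x + Tr (suc k) x * Tr (suc k) x ∎
    where
    open ≡-Reasoning
    T = Tr k x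
    P = x ^ (2 ℕ.^ k)

  -- If a = t + 1/t and t = as, then s² + s = 1/a² and the 2^k-th power of s
  -- is s + Tr(1/a²); hence the trace on the right.
  dickson-1+2^ : ∀ a → a ≢ 0# → ∀ k →
    dickson (suc (2 ℕ.^ k)) a ≡ a ^ (2 ℕ.^ k) * a * (1# + Tr k (a ⁻¹) * Tr k (a ⁻¹))
  dickson-1+2^ a a≢0 zero = solve 1 (λ a → a :* a :+ :0 := a :* :1 :* a :* (:1 :+ :0 :* :0)) refl a
  dickson-1+2^ a a≢0 (suc k) = *-cancelˡ a≢0 (begin
    a * D (suc Q₂)
      ≡⟨ solve 2 (λ u v → u := (u :+ v) :+ v) refl (a * D (suc Q₂)) (D Q₂) ⟩
    D (suc (suc Q₂)) + D Q₂
      ≡⟨ cong₂ _+_ (trans (cong D double-suc) (dickson-double (suc Q) a))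
          (trans (dickson-2^ (suc k) a) (^-2^suc a k)) ⟩
    D (suc Q) * D (suc Q) + A * A
      ≡⟨ cong (λ d → d * d + A * A) (dickson-1+2^ a a≢0 k) ⟩
    A * a * (1# + T * T) * (A * a * (1# + T * T)) + A * A
      -- The factor 1 is made visible in order to become a · a⁻¹, which supplies the new summand a⁻¹
      -- of the partial trace.
      ≡⟨ solve 2 (λ u A → u :+ A :* A := u :+ A :* A :* (:1 :* :1))
          refl (A * a * (1# + T * T) * (A * a * (1# + T * T))) A ⟩
    A * a * (1# + T * T) * (A * a * (1# + T * T)) + A * A * (1# * 1#)
      ≡⟨ cong (λ u → A * a * (1# + T * T) * (A * a * (1# + T * T)) + A * A * (u * u)) (inverseʳ a a≢0) ⟨
    A * a * (1# + T * T) * (A * a * (1# + T * T)) + A * A * (a * b * (a * b))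
      ≡⟨ solve 4 (λ A a b T → A :* a :* (:1 :+ T :* T) :* (A :* a :* (:1 :+ T :* T)) :+ A :* A :* (a :* b :* (a :* b))
                 := a :* (A :* A :* a :* (:1 :+ (b :+ T :* T) :* (b :+ T :* T)))) refl A a b T ⟩
    a * (A * A * a * (1# + (b + T * T) * (b + T * T)))
      ≡⟨ cong₂ (λ u v → a * (u * a * (1# + v * v))) (^-2^suc a k) (Tr-suc k b) ⟨
    a * (a ^ Q₂ * a * (1# + Tr (suc k) b * Tr (suc k) b)) ∎)
    where
    open ≡-Reasoning
    D = λ j → dickson j a
    Q = 2 ℕ.^ k
    Q₂ = 2 ℕ.^ suc k
    A = a ^ Q
    b = a ⁻¹
    T = Tr k b
    double-suc : suc (suc (2 ℕ.^ suc k)) ≡ suc Q ℕ.+ (suc Q ℕ.+ 0)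
    double-suc = ℕsolve 1 (λ Q → κ 2 ⊕ (Q ⊕ (Q ⊕ κ 0)) ⊜ (κ 1 ⊕ Q) ⊕ ((κ 1 ⊕ Q) ⊕ κ 0)) refl Q

-- Frobenius on the roots of the cubic, and their existence in K

module CubicFields (m-1 : ℕ) (K : GF2Field (3 ℕ.* suc m-1)) where
  open GF2Field K hiding (dickson) renaming (Carrier to C)
  open FiniteField K
  open Traces K

  m q n : ℕ
  m = suc m-1
  q = 2 ℕ.^ m
  n = (q ℕ.+ 1) ℕ./ 3

  frobenius³ : ∀ x → ((x ^ q) ^ q) ^ q ≡ x
  frobenius³ x = trans (^-2^[3*] m x) (fermat x)

  -- A seventh root of unity other than 1 is a root of (X³ + X + 1)(X³ + X² + 1).
  𝔽₈-generator : ∃ λ w → w ^ 3 + w + 1# ≡ 0#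
  𝔽₈-generator with 8^-mod-7 m-1
  -- The vector stands for Y^(k+2) + Y = Y (Y^(k+1) + 1). A nonroot y is therefore nonzero with
  -- y^(k+1) ≠ 1, and |K| - 1 = 7(k + 1).
  ... | k , |K|≡ with monic-nonroot (0# ∷ 1# ∷ replicate k 0#) (subst (2 ℕ.+ k ℕ.<_) (sym |K|≡) 2+k<)
    where
    2+k< : 2 ℕ.+ k ℕ.< suc (suc k ℕ.* 7)
    2+k< = ℕₚ.≤-trans (ℕₚ.m≤m+n (3 ℕ.+ k) (5 ℕ.+ 6 ℕ.* k))
      (ℕₚ.≤-reflexive (ℕsolve 1 (λ k → κ 3 ⊕ k ⊕ (κ 5 ⊕ κ 6 ⊗ k) ⊜ κ 1 ⊕ (κ 1 ⊕ k) ⊗ κ 7) refl k))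
  ... | y , nonroot = generator
    where
    open ≡-Reasoning
    w = y ^ suc k

    y*[w+1]≢0 : y * (w + 1#) ≢ 0#
    y*[w+1]≢0 eq = nonroot (trans (+-identityʳ _) (trans (cong (λ t → y * (y * t + 1#)) (monic-zeros k y)) eq))

    y≢0 : y ≢ 0#
    y≢0 y≡0 = y*[w+1]≢0 (trans (cong (_* (w + 1#)) y≡0) (zeroˡ _))

    w+1≢0 : w + 1# ≢ 0#
    w+1≢0 eq = y*[w+1]≢0 (trans (cong (y *_) eq) (zeroʳ y))

    w⁷≡1 : w ^ 7 ≡ 1#
    w⁷≡1 = trans (^-assocʳ y (suc k) 7) (nonzero-order (suc k ℕ.* 7) (sym |K|≡) y≢0)

    factors : (w ^ 3 + w + 1#) * (w ^ 3 + w * w + 1#) ≡ 0#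
    factors = x*y≡0 (trans
      (solve 1 (λ w → (w :+ :1) :* ((w :^ 3 :+ w :+ :1) :* (w :^ 3 :+ w :* w :+ :1)) := w :^ 7 :+ :1) refl w)
      (≡⇒+≡0 w⁷≡1)) w+1≢0

    generator : ∃ λ w → w ^ 3 + w + 1# ≡ 0#
    generator with (w ^ 3 + w + 1#) ≟ 0#
    ... | yes root = w , root
    ... | no ¬root = w + 1# , trans
      (solve 1 (λ w → (w :+ :1) :^ 3 :+ (w :+ :1) :+ :1 := w :^ 3 :+ w :* w :+ :1) refl w) (x*y≡0 factors ¬root)

  module RootsOfCubic
    (a : C) (a^q≡a : a ^ q ≡ a) (a≢0 : a ≢ 0#) (Tr-a⁻¹≡Tr-1 : Tr m (a ⁻¹) ≡ Tr m 1#)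
    where

    δ : C
    δ = dickson n a

    private
      -- `dickson-1+2^` evaluates D_{q+1}(a) by the trace. If the trace is 1, then 3n = q + 1 and
      -- the value is 0. If it is 0, then 3n = q - 1 and the value is a²; the recurrence run
      -- backwards from D_q(a) = a yields D_{q-1}(a) = a² + a² = 0.
      index-split : ∃ λ p → n ℕ.* 3 ≡ suc p × (q ≡ p ⊎ q ≡ 2 ℕ.+ p) × dickson (suc p) a ≡ 0#
      index-split with Tr-1 m-1
      ... | inj₁ (k , q≡ , Tr≡0) = 2 ℕ.+ k ℕ.* 3 , 3n≡ , inj₂ q≡ , D≡0
        where
        open ≡-Reasoning
        D = λ j → dickson j a
        3n≡ : n ℕ.* 3 ≡ suc k ℕ.* 3
        3n≡ = cong (ℕ._* 3) (begin
          (q ℕ.+ 1) ℕ./ 3                 ≡⟨ cong (ℕ._/ 3) (ℕₚ.+-comm q 1) ⟩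
          suc q ℕ./ 3                     ≡⟨ cong (λ j → suc j ℕ./ 3) q≡ ⟩
          (2 ℕ.+ suc k ℕ.* 3) ℕ./ 3       ≡⟨ +-distrib-/-∣ʳ 2 {suc k ℕ.* 3} {3} (divides (suc k) refl) ⟩
          suc k ℕ.* 3 ℕ./ 3               ≡⟨ m*n/n≡m (suc k) 3 ⟩
          suc k                           ∎)
        Dq≡a : D q ≡ a
        Dq≡a = trans (dickson-2^ m a) a^q≡a
        D[1+q]≡ : D (suc q) ≡ a * a
        D[1+q]≡ = begin
          D (suc q)
            ≡⟨ dickson-1+2^ a a≢0 m ⟩
          a ^ q * a * (1# + Tr m (a ⁻¹) * Tr m (a ⁻¹))
            ≡⟨ cong₂ (λ u t → u * a * (1# + t * t)) a^q≡a (trans Tr-a⁻¹≡Tr-1 Tr≡0) ⟩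
          a * a * (1# + 0# * 0#)
            ≡⟨ solve 1 (λ a → a :* a :* (:1 :+ :0 :* :0) := a :* a) refl a ⟩
          a * a ∎
        D≡0 : D (suc k ℕ.* 3) ≡ 0#
        D≡0 = begin
          D (suc k ℕ.* 3)
            ≡⟨ solve 2 (λ u v → v := u :+ (u :+ v)) refl (a * D (suc (suc k ℕ.* 3))) (D (suc k ℕ.* 3)) ⟩
          a * D (suc (suc k ℕ.* 3)) + D (suc (suc (suc k ℕ.* 3)))
            ≡⟨ cong (λ j → a * D j + D (suc j)) q≡ ⟨
          a * D q + D (suc q)
            ≡⟨ cong₂ (λ u v → a * u + v) Dq≡a D[1+q]≡ ⟩
          a * a + a * a
            ≡⟨ double _ ⟩
          0# ∎
      ... | inj₂ (k , q≡ , Tr≡1) = 2 ℕ.+ k ℕ.* 3 , 3n≡ , inj₁ q≡ , D≡0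
        where
        open ≡-Reasoning
        3n≡ : n ℕ.* 3 ≡ suc k ℕ.* 3
        3n≡ = cong (ℕ._* 3) (begin
          (q ℕ.+ 1) ℕ./ 3                 ≡⟨ cong (ℕ._/ 3) (ℕₚ.+-comm q 1) ⟩
          suc q ℕ./ 3                     ≡⟨ cong (λ j → suc j ℕ./ 3) q≡ ⟩
          suc k ℕ.* 3 ℕ./ 3               ≡⟨ m*n/n≡m (suc k) 3 ⟩
          suc k                           ∎)
        D≡0 : dickson (suc k ℕ.* 3) a ≡ 0#
        D≡0 = begin
          dickson (suc k ℕ.* 3) a
            ≡⟨ cong (λ j → dickson (suc j) a) q≡ ⟨
          dickson (suc q) a
            ≡⟨ dickson-1+2^ a a≢0 m ⟩
          a ^ q * a * (1# + Tr m (a ⁻¹) * Tr m (a ⁻¹))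
            ≡⟨ cong (λ t → a ^ q * a * (1# + t * t)) (trans Tr-a⁻¹≡Tr-1 Tr≡1) ⟩
          a ^ q * a * (1# + 1# * 1#)
            ≡⟨ solve 2 (λ u a → u :* a :* (:1 :+ :1 :* :1) := :0) refl (a ^ q) a ⟩
          0# ∎

      p : ℕ
      p = proj₁ index-split

      3n≡1+p : n ℕ.* 3 ≡ suc p
      3n≡1+p = proj₁ (proj₂ index-split)

      q-split : q ≡ p ⊎ q ≡ 2 ℕ.+ p
      q-split = proj₁ (proj₂ (proj₂ index-split))

    -- D₃(δ) = D_{3n}(a) = 0, and D₃(δ) = δ (δ + 1)² in characteristic 2.
    δ≡0⊎δ≡1 : δ ≡ 0# ⊎ δ ≡ 1#
    δ≡0⊎δ≡1 with δ ≟ 0#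
    ... | yes δ≡0 = inj₁ δ≡0
    ... | no  δ≢0 = inj₂ (+≡0⇒≡ (x*x≡0 (x*y≡0 (begin
      δ * ((δ + 1#) * (δ + 1#))   ≡⟨ solve 1 (λ δ → δ :* ((δ :+ :1) :* (δ :+ :1)) := δ :^ 3 :+ δ) refl δ ⟩
      δ ^ 3 + δ                   ≡⟨ dickson-3 δ ⟨
      dickson 3 δ                 ≡⟨ dickson-∘ 3 n a ⟩
      dickson (3 ℕ.* n) a         ≡⟨ cong (λ j → dickson j a) (trans (ℕₚ.*-comm 3 n) 3n≡1+p) ⟩
      dickson (suc p) a           ≡⟨ proj₂ (proj₂ (proj₂ index-split)) ⟩
      0#                          ∎) δ≢0)))
      where open ≡-Reasoning

    cubic : C → C
    cubic r = r ^ 3 + r + a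

    module _ {r : C} (r-root : cubic r ≡ 0#) where
      private module F = CubicFrobenius r a (+≡0⇒≡ r-root) m n p 3n≡1+p q-split

      root-frobenius-δ≡0 : δ ≡ 0# → r ^ q ≡ r
      root-frobenius-δ≡0 δ≡0 = square-injective (F.frobenius-δ≡0 δ≡0)

      root-frobenius²-δ≡1 : δ ≡ 1# → (r ^ q) ^ q ≡ r + r ^ q
      root-frobenius²-δ≡1 δ≡1 = square-injective (F.frobenius² δ≡1)

      -- At y = r the quadratic reduces to r² + 1 = 0, and then a = r (r² + 1) vanishes.
      root-frobenius-δ≡1 : δ ≡ 1# → r ^ q ≢ r
      root-frobenius-δ≡1 δ≡1 r^q≡r = a≢0 (begin
        a                                   ≡⟨ +≡0⇒≡
            (trans (solve 2 (λ r a → a :+ r :* (r :* r :+ :1) := r :^ 3 :+ r :+ a) refl r a) r-root) ⟩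
        r * (r * r + 1#)                    ≡⟨ cong (r *_)
            (trans (solve 1 (λ r → r :* r :+ :1 := r :* r :+ r :* r :+ r :* r :+ :1) refl r)
                                                 (subst
                                                     (λ y → y * y + r * y + r * r + 1# ≡ 0#) r^q≡r (F.frobenius-δ≡1 δ≡1))) ⟩
        r * 0#                              ≡⟨ zeroʳ r ⟩
        0#                                  ∎)
        where open ≡-Reasoning

    private
      open CubicAlgebra charTwoRing a
      module 𝔸 = CharTwoTheory cubicRing
      module F = 𝔸.CubicFrobenius X (constant a) X³+X≡a m n p 3n≡1+p q-split

      -- For a ≠ 0 the cubic is separable and the algebra has no nilpotents. In coordinates, a f₂²
      -- determines f₂, and then f₁² + f₂² determines f₁.
      ⊠-square-injective : ∀ {f g} → f ⊠ f ≡ g ⊠ g → f ≡ g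
      ⊠-square-injective {f₀ , f₁ , f₂} {g₀ , g₁ , g₂} eq = triple (square-injective (cong proj₁ eq′)) f₁≡g₁ f₂≡g₂
        where
        eq′ = trans (sym (square-coordinates f₀ f₁ f₂)) (trans eq (square-coordinates g₀ g₁ g₂))
        f₂≡g₂ : f₂ ≡ g₂
        f₂≡g₂ = square-injective (*-cancelˡ a≢0 (cong (proj₁ ∘ proj₂) eq′))
        f₁≡g₁ : f₁ ≡ g₁
        f₁≡g₁ = square-injective (+≡0⇒≡ (begin
          f₁ * f₁ + g₁ * g₁
            ≡⟨ solve 3 (λ f g s → f :* f :+ g :* g := (f :* f :+ s) :+ (g :* g :+ s)) refl f₁ g₁ (f₂ * f₂) ⟩
          (f₁ * f₁ + f₂ * f₂) + (g₁ * g₁ + f₂ * f₂)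
            ≡⟨ cong (λ s → (f₁ * f₁ + f₂ * f₂) + (g₁ * g₁ + s * s)) f₂≡g₂ ⟩
          (f₁ * f₁ + f₂ * f₂) + (g₁ * g₁ + g₂ * g₂)
            ≡⟨ ≡⇒+≡0 (cong (proj₂ ∘ proj₂) eq′) ⟩
          0# ∎))
          where open ≡-Reasoning

      X-frobenius³ : ((X 𝔸.^ q) 𝔸.^ q) 𝔸.^ q ≡ X
      X-frobenius³ with δ≡0⊎δ≡1
      ... | inj₁ δ≡0 = trans (cong (λ f → (f 𝔸.^ q) 𝔸.^ q) Y≡X) (trans (cong (𝔸._^ q) Y≡X) Y≡X)
        where
        Y≡X : X 𝔸.^ q ≡ X
        Y≡X = ⊠-square-injective (F.frobenius-δ≡0 (trans (dickson-constant n a) (cong constant δ≡0)))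
      ... | inj₂ δ≡1 = begin
        Z 𝔸.^ q                 ≡⟨ cong (𝔸._^ q) Z≡X+Y ⟩
        (X ⊞ Y) 𝔸.^ q           ≡⟨ 𝔸.frobenius-+ m X Y ⟩
        Y ⊞ Z                   ≡⟨ cong (Y ⊞_) Z≡X+Y ⟩
        Y ⊞ (X ⊞ Y)             ≡⟨ 𝔸.solve 2 (λ x y → y 𝔸.:+ (x 𝔸.:+ y) 𝔸.:= x) refl X Y ⟩
        X                       ∎
        where
        open ≡-Reasoning
        Y = X 𝔸.^ q
        Z = Y 𝔸.^ q
        Z≡X+Y : Z ≡ X ⊞ Y
        Z≡X+Y = ⊠-square-injective (F.frobenius² (trans (dickson-constant n a) (cong constant δ≡1)))

      X-fermat : X 𝔸.^ (2 ℕ.^ (3 ℕ.* m)) ≡ X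
      X-fermat = trans (sym (𝔸.^-2^[3*] m X)) X-frobenius³

      -- Quotient of X^(3+k) by the cubic; the remainder is the power X^(3+k) in cubicRing.
      quotients : ∀ k → Vec C k
      quotients zero    = []
      quotients (suc k) = leading (X 𝔸.^ (3 ℕ.+ k)) ∷ quotients k

      division : ∀ k r → r ^ (3 ℕ.+ k) + evaluate r (X 𝔸.^ (3 ℕ.+ k)) ≡ cubic r * monic (quotients k) r
      division zero r = begin
        r ^ 3 + evaluate r (X 𝔸.^ 3)
          ≡⟨ cong (λ f → r ^ 3 + evaluate r f) (trans (𝔸.solve 2 (λ u v → u 𝔸.:= (u 𝔸.:+ v) 𝔸.:+ v)
              refl (X 𝔸.^ 3) X) (cong (_⊞ X) X³+X≡a)) ⟩
        r ^ 3 + evaluate r (constant a ⊞ X)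
          ≡⟨ solve 2 (λ r a → r :^ 3 :+ (a :+ :0 :+ (:0 :+ :1) :* r :+ (:0 :+ :0) :* (r :* r))
              := (r :^ 3 :+ r :+ a) :* :1) refl r a ⟩
        cubic r * 1# ∎
        where open ≡-Reasoning
      division (suc k) r = begin
        r * R + evaluate r (X ⊠ P)
          ≡⟨ cong (r * R +_) (solve 2 (λ u v → u := (u :+ v) :+ v) refl (evaluate r (X ⊠ P)) (leading P * cubic r)) ⟩
        r * R + (evaluate r (X ⊠ P) + leading P * cubic r + leading P * cubic r)
          ≡⟨ cong (λ e → r * R + (e + leading P * cubic r)) (evaluate-X⊠ r P) ⟨
        r * R + (r * evaluate r P + leading P * cubic r)
          ≡⟨ solve 5 (λ r R E L c → r :* R :+ (r :* E :+ L :* c) := r :* (R :+ E) :+ L :* c)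
              refl r R (evaluate r P) (leading P) (cubic r) ⟩
        r * (R + evaluate r P) + leading P * cubic r
          ≡⟨ cong (λ e → r * e + leading P * cubic r) (division k r) ⟩
        r * (cubic r * monic (quotients k) r) + leading P * cubic r
          ≡⟨ solve 4 (λ r c h L → r :* (c :* h) :+ L :* c := c :* (r :* h :+ L))
              refl r (cubic r) (monic (quotients k) r) (leading P) ⟩
        cubic r * (r * monic (quotients k) r + leading P) ∎
        where
        open ≡-Reasoning
        R = r ^ (3 ℕ.+ k)
        P = X 𝔸.^ (3 ℕ.+ k)

      division′ : ∀ {k j} → 3 ℕ.+ k ≡ j → ∀ r → r ^ j + evaluate r (X 𝔸.^ j) ≡ cubic r * monic (quotients k) r
      division′ {k} refl = division k

      cubic*quotient≡0 : ∀ {k} → 3 ℕ.+ k ≡ 2 ℕ.^ (3 ℕ.* m) → ∀ r → cubic r * monic (quotients k) r ≡ 0#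
      cubic*quotient≡0 {k} 3+k≡ r = begin
        cubic r * monic (quotients k) r
          ≡⟨ division′ 3+k≡ r ⟨
        r ^ (2 ℕ.^ (3 ℕ.* m)) + evaluate r (X 𝔸.^ (2 ℕ.^ (3 ℕ.* m)))
          ≡⟨ cong₂ (λ u f → u + evaluate r f) (fermat r) X-fermat ⟩
        r + evaluate r X
          ≡⟨ solve 1 (λ r → r :+ (:0 :+ :1 :* r :+ :0 :* (r :* r)) := :0) refl r ⟩
        0# ∎
        where open ≡-Reasoning

      TwoRoots : Set
      TwoRoots = ∃₂ λ r s → r ≢ s × cubic r ≡ 0# × cubic s ≡ 0#

      -- As h has degree |K| - 3, some r is not a root of h and must be a root of the cubic. The
      -- product (X + r) h has degree |K| - 2, still below |K|, and a nonroot of it is a second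
      -- root. The third root is the sum of these two.
      two-roots-from : ∀ {d} (h : Vec C d) → 3 ℕ.+ d ≡ 2 ℕ.^ (3 ℕ.* m) → (∀ r → cubic r * monic h r ≡ 0#) → TwoRoots
      two-roots-from {d} h 3+d≡ cubic*h≡0
        with r , hr≢0 ← monic-nonroot h (subst (d ℕ.<_) 3+d≡ (ℕₚ.m≤n+m (suc d) 2))
        with s , gs≢0 ← monic-nonroot (timesLinear r h) (subst (suc d ℕ.<_) 3+d≡ (ℕₚ.m≤n+m (2 ℕ.+ d) 1))
        = r , s
        , (λ r≡s → gs≢0 (trans (monic-timesLinear r h s) (trans (cong (_* monic h s) (≡⇒+≡0 (sym r≡s))) (zeroˡ _))))
        , root hr≢0
        , root (λ hs≡0 → gs≢0 (trans (monic-timesLinear r h s) (trans (cong ((s + r) *_) hs≡0) (zeroʳ _))))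
        where
        root : ∀ {x} → monic h x ≢ 0# → cubic x ≡ 0#
        root {x} hx≢0 = x*y≡0 (trans (*-comm _ _) (cubic*h≡0 x)) hx≢0

    two-roots : ∃₂ λ r s → r ≢ s × cubic r ≡ 0# × cubic s ≡ 0#
    two-roots = from-degree (8^-mod-7 m-1)
      where
      from-degree : (∃ λ k → 2 ℕ.^ (3 ℕ.* m) ≡ suc (suc k ℕ.* 7)) → TwoRoots
      -- |K| = 8 + 7k, so the quotient of X^|K| by the cubic has degree 5 + 7k.
      from-degree (k , |K|≡) = two-roots-from (quotients (5 ℕ.+ k ℕ.* 7)) (sym |K|≡) (cubic*quotient≡0 (sym |K|≡))

-- The subfield 𝔽₈

module Subfield₈ {e : ℕ} (K : GF2Field e) where
  open GF2Field K hiding (dickson) renaming (Carrier to C)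
  open FiniteField K

  -- The two irreducible cubics over 𝔽₂: minimal polynomials of the elements of 𝔽₈ outside 𝔽₂.
  α β : C → C
  α s = s ^ 3 + s + 1#
  β s = s ^ 3 + s * s + 1#

  s⁸+s-factors : ∀ s → s * (s + 1#) * (α s * β s) ≡ s ^ 8 + s
  s⁸+s-factors = solve 1 (λ s → s :* (s :+ :1) :* ((s :^ 3 :+ s :+ :1) :* (s :^ 3 :+ s :* s :+ :1))
      := s :^ 8 :+ s) refl

  β≡α[s+1] : ∀ s → β s ≡ α (s + 1#)
  β≡α[s+1] = solve 1 (λ s → s :^ 3 :+ s :* s :+ :1 := (s :+ :1) :^ 3 :+ (s :+ :1) :+ :1) refl

  α≡0⇒𝔽₈ : ∀ {s} → α s ≡ 0# → s ^ 8 ≡ s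
  α≡0⇒𝔽₈ {s} α≡0 = +≡0⇒≡ (trans (sym (s⁸+s-factors s))
    (trans (cong (λ t → s * (s + 1#) * (t * β s)) α≡0) (solve 2 (λ u v → u :* (:0 :* v) := :0) refl _ _)))

  β≡0⇒𝔽₈ : ∀ {s} → β s ≡ 0# → s ^ 8 ≡ s
  β≡0⇒𝔽₈ {s} β≡0 = +≡0⇒≡ (trans (sym (s⁸+s-factors s))
    (trans (cong (λ t → s * (s + 1#) * (α s * t)) β≡0) (solve 2 (λ u v → u :* (v :* :0) := :0) refl _ _)))

  α-β-disjoint : ∀ {s} → α s ≡ 0# → β s ≢ 0#
  α-β-disjoint {s} α≡0 β≡0 = 0≢1 (sym (begin
    1#                                          ≡⟨ solve 1
        (λ s → :1 := s :* (s :^ 3 :+ s :+ :1) :+ (s :+ :1) :* (s :^ 3 :+ s :* s :+ :1)) refl s ⟩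
    s * α s + (s + 1#) * β s                    ≡⟨ cong₂ (λ u v → s * u + (s + 1#) * v) α≡0 β≡0 ⟩
    s * 0# + (s + 1#) * 0#                      ≡⟨ solve 1 (λ s → s :* :0 :+ (s :+ :1) :* :0 := :0) refl s ⟩
    0#                                          ∎))
    where open ≡-Reasoning

  x*y≡0⇒ : ∀ {x y} → x * y ≡ 0# → x ≡ 0# ⊎ y ≡ 0#
  x*y≡0⇒ {x} eq with x ≟ 0#
  ... | yes x≡0 = inj₁ x≡0
  ... | no  x≢0 = inj₂ (x*y≡0 eq x≢0)

  𝔽₈-cases : ∀ {s} → s ^ 8 ≡ s → (s ≡ 0# ⊎ s ≡ 1#) ⊎ (α s ≡ 0# ⊎ β s ≡ 0#)
  𝔽₈-cases {s} s⁸≡s with x*y≡0⇒ (trans (s⁸+s-factors s) (≡⇒+≡0 s⁸≡s))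
  ... | inj₂ αβ≡0 = inj₂ (x*y≡0⇒ αβ≡0)
  ... | inj₁ s[s+1]≡0 with x*y≡0⇒ s[s+1]≡0
  ... | inj₁ s≡0   = inj₁ (inj₁ s≡0)
  ... | inj₂ s+1≡0 = inj₁ (inj₂ (+≡0⇒≡ s+1≡0))

  -- A Bézout identity for X² + X + 1 and X⁸ + X: 𝔽₈ does not contain 𝔽₄. The factor X² + X + 1
  -- arises when σ permutes the roots of the cubic cyclically, and in one case it is the whole
  -- equation, which leaves no roots.
  no-cube-root-of-unity-in-𝔽₈ : ∀ {s} → s ^ 8 ≡ s → s * s + s + 1# ≢ 0#
  no-cube-root-of-unity-in-𝔽₈ {s} s⁸≡s eq = 0≢1 (sym (begin
    1#
      ≡⟨ solve 1 (λ s → :1 := (s :* s :+ s :+ :1) :* (s :^ 6 :+ s :^ 5 :+ s :^ 3 :+ s :^ 2 :+ :1) :+ (s :^ 8 :+ s)) refl s ⟩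
    (s * s + s + 1#) * (s ^ 6 + s ^ 5 + s ^ 3 + s ^ 2 + 1#) + (s ^ 8 + s)
      ≡⟨ cong₂ (λ u v → u * (s ^ 6 + s ^ 5 + s ^ 3 + s ^ 2 + 1#) + v) eq (≡⇒+≡0 s⁸≡s) ⟩
    0# * (s ^ 6 + s ^ 5 + s ^ 3 + s ^ 2 + 1#) + 0#
      ≡⟨ solve 1 (λ u → :0 :* u :+ :0 := :0) refl _ ⟩
    0# ∎))
    where open ≡-Reasoning

  module _ {w : C} (αw≡0 : α w ≡ 0#) where

    -- Since w⁴ = w² + w, `roots-α` is the Frobenius orbit of w; adding 1 exchanges the roots of `α`
    -- and `β`.
    𝔽₂ roots-α roots-β 𝔽₈ : List C
    𝔽₂      = 0# ∷ 1# ∷ []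
    roots-α = w ∷ w * w ∷ w * w + w ∷ []
    roots-β = map (_+ 1#) roots-α
    𝔽₈      = 𝔽₂ ++ (roots-α ++ roots-β)

    private
      α-splits : ∀ s → (s + w) * ((s + w * w) * (s + (w * w + w))) ≡ α s
      α-splits s = begin
        (s + w) * ((s + w * w) * (s + (w * w + w)))
          ≡⟨ solve 2 (λ s w → (s :+ w) :* ((s :+ w :* w) :* (s :+ (w :* w :+ w)))
               := (s :^ 3 :+ s :+ :1) :+ (w :^ 3 :+ w :+ :1) :* (s :* (w :+ :1) :+ (w :* w :+ w :+ :1))) refl s w ⟩
        α s + α w * (s * (w + 1#) + (w * w + w + 1#))
          ≡⟨ cong (λ t → α s + t * (s * (w + 1#) + (w * w + w + 1#))) αw≡0 ⟩
        α s + 0# * (s * (w + 1#) + (w * w + w + 1#))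
          ≡⟨ solve 2 (λ u v → u :+ :0 :* v := u) refl _ _ ⟩
        α s ∎
        where open ≡-Reasoning

      α0≢0 : α 0# ≢ 0#
      α0≢0 eq = 0≢1 (trans (sym eq) (solve 0 (:0 :^ 3 :+ :0 :+ :1 := :1) refl))

      α1≢0 : α 1# ≢ 0#
      α1≢0 eq = 0≢1 (trans (sym eq) (solve 0 (:1 :^ 3 :+ :1 :+ :1 := :1) refl))

      w≢0 : w ≢ 0#
      w≢0 w≡0 = α0≢0 (subst (λ t → α t ≡ 0#) w≡0 αw≡0)

      w+1≢0 : w + 1# ≢ 0#
      w+1≢0 w+1≡0 = α1≢0 (subst (λ t → α t ≡ 0#) (+≡0⇒≡ w+1≡0) αw≡0)

    roots-α-sound : ∀ {s} → s ∈ roots-α → α s ≡ 0#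
    roots-α-sound (here refl) = αw≡0
    roots-α-sound (there (here refl)) = trans (sym (α-splits (w * w)))
      (solve 1 (λ w → (w :* w :+ w) :* ((w :* w :+ w :* w) :* (w :* w :+ (w :* w :+ w))) := :0) refl w)
    roots-α-sound (there (there (here refl))) = trans (sym (α-splits (w * w + w)))
      (solve 1 (λ w → let s = w :* w :+ w in (s :+ w) :* ((s :+ w :* w) :* (s :+ s)) := :0) refl w)

    roots-α-complete : ∀ {s} → α s ≡ 0# → s ∈ roots-α
    roots-α-complete {s} αs≡0 with x*y≡0⇒ (trans (α-splits s) αs≡0)
    ... | inj₁ eq = here (+≡0⇒≡ eq)
    ... | inj₂ eq with x*y≡0⇒ eq
    ... | inj₁ eq = there (here (+≡0⇒≡ eq))
    ... | inj₂ eq = there (there (here (+≡0⇒≡ eq)))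

    roots-β-sound : ∀ {s} → s ∈ roots-β → β s ≡ 0#
    roots-β-sound s∈ with ∈-map⁻ (_+ 1#) s∈
    ... | t , t∈ , refl = trans (β≡α[s+1] (t + 1#))
      (trans (cong α (solve 1 (λ t → t :+ :1 :+ :1 := t) refl t)) (roots-α-sound t∈))

    roots-β-complete : ∀ {s} → β s ≡ 0# → s ∈ roots-β
    roots-β-complete {s} βs≡0 = subst (_∈ roots-β) (solve 1 (λ s → s :+ :1 :+ :1 := s) refl s)
      (∈-map⁺ (_+ 1#) (roots-α-complete (trans (sym (β≡α[s+1] s)) βs≡0)))

    𝔽₂-unique : Unique 𝔽₂
    𝔽₂-unique = (0≢1 ∷ []) ∷ [] ∷ []

    roots-α-unique : Unique roots-α
    roots-α-unique = (w≢w² ∷ w≢w²+w ∷ []) ∷ (w²≢w²+w ∷ []) ∷ [] ∷ []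
      where
      w≢w² : w ≢ w * w
      w≢w² eq = *-≢0 w≢0 w+1≢0 (trans (solve 1 (λ w → w :* (w :+ :1) := w :+ w :* w) refl w) (≡⇒+≡0 eq))
      w≢w²+w : w ≢ w * w + w
      w≢w²+w eq = *-≢0 w≢0 w≢0 (trans (solve 1 (λ w → w :* w := w :+ (w :* w :+ w)) refl w) (≡⇒+≡0 eq))
      w²≢w²+w : w * w ≢ w * w + w
      w²≢w²+w eq = w≢0 (trans (solve 1 (λ w → w := w :* w :+ (w :* w :+ w)) refl w) (≡⇒+≡0 eq))

    roots-β-unique : Unique roots-β
    roots-β-unique = Unique.map⁺ (λ {x} {y} eq → +≡0⇒≡ (trans
      (solve 2 (λ x y → x :+ y := (x :+ :1) :+ (y :+ :1)) refl x y) (≡⇒+≡0 eq))) roots-α-unique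

    𝔽₂-in-𝔽₈ : ∀ {s} → s ∈ 𝔽₂ → s ^ 8 ≡ s
    𝔽₂-in-𝔽₈ (here refl)         = zeroˡ _
    𝔽₂-in-𝔽₈ (there (here refl)) = 1^ 8

    𝔽₈-sound : ∀ {s} → s ∈ 𝔽₈ → s ^ 8 ≡ s
    𝔽₈-sound s∈ with ∈-++⁻ 𝔽₂ s∈
    ... | inj₁ s∈𝔽₂ = 𝔽₂-in-𝔽₈ s∈𝔽₂
    ... | inj₂ s∈αβ with ∈-++⁻ roots-α s∈αβ
    ... | inj₁ s∈α = α≡0⇒𝔽₈ (roots-α-sound s∈α)
    ... | inj₂ s∈β = β≡0⇒𝔽₈ (roots-β-sound s∈β)

    𝔽₈-complete : ∀ {s} → s ^ 8 ≡ s → s ∈ 𝔽₈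
    𝔽₈-complete s⁸≡s with 𝔽₈-cases s⁸≡s
    ... | inj₁ (inj₁ s≡0) = here s≡0
    ... | inj₁ (inj₂ s≡1) = there (here s≡1)
    ... | inj₂ (inj₁ α≡0) = ∈-++⁺ʳ 𝔽₂ (∈-++⁺ˡ (roots-α-complete α≡0))
    ... | inj₂ (inj₂ β≡0) = ∈-++⁺ʳ 𝔽₂ (∈-++⁺ʳ roots-α (roots-β-complete β≡0))

    𝔽₈-unique : Unique 𝔽₈
    𝔽₈-unique = Unique.++⁺ 𝔽₂-unique
      (Unique.++⁺ roots-α-unique roots-β-unique (λ (s∈α
          , s∈β) → α-β-disjoint (roots-α-sound s∈α) (roots-β-sound s∈β)))
      (λ (s∈𝔽₂ , s∈αβ) → disjoint s∈𝔽₂ (∈-++⁻ roots-α s∈αβ))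
      where
      β0≢0 : β 0# ≢ 0#
      β0≢0 eq = α1≢0 (trans (cong α (sym (+-identityˡ 1#))) (trans (sym (β≡α[s+1] 0#)) eq))
      β1≢0 : β 1# ≢ 0#
      β1≢0 eq = α0≢0 (trans (cong α (sym char2)) (trans (sym (β≡α[s+1] 1#)) eq))
      disjoint : ∀ {s} → s ∈ 𝔽₂ → ¬ (s ∈ roots-α ⊎ s ∈ roots-β)
      disjoint (here refl)         (inj₁ s∈α) = α0≢0 (roots-α-sound s∈α)
      disjoint (here refl)         (inj₂ s∈β) = β0≢0 (roots-β-sound s∈β)
      disjoint (there (here refl)) (inj₁ s∈α) = α1≢0 (roots-α-sound s∈α)
      disjoint (there (here refl)) (inj₂ s∈β) = β1≢0 (roots-β-sound s∈β)

-- Injectivity is asked only on P because the map `point` is injective only where its denominator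
-- does not vanish.
Unique-map-on : ∀ {A B : Set} (P : A → Set) {f : A → B} → (∀ {s t} → P s → P t → f s ≡ f t → s ≡ t) →
  ∀ {xs} → All P xs → Unique xs → Unique (map f xs)
Unique-map-on P inj []         []            = []
Unique-map-on P inj (px ∷ pxs) (x∉xs ∷ xs!) =
  All.map⁺ (All.zipWith (λ (py , x≢y) fx≡fy → x≢y (inj px py fx≡fy)) (pxs , x∉xs)) ∷ Unique-map-on P inj pxs xs!

-- The projective coordinate s and the reduction to parameters in 𝔽₈

module Points {e : ℕ} (K : GF2Field e) where
  open GF2Field K hiding (dickson) renaming (Carrier to C)
  open FiniteField K

  module Parametrization
    (a r₁ r₃ : C) (a≢0 : a ≢ 0#) (a≢1 : a ≢ 1#)
    (r₁-root : r₁ ^ 3 + r₁ + a ≡ 0#) (r₃-root : r₃ ^ 3 + r₃ + a ≡ 0#) (r₁≢r₃ : r₁ ≢ r₃)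
    where

    r₁+r₃≢0 : r₁ + r₃ ≢ 0#
    r₁+r₃≢0 eq = r₁≢r₃ (+≡0⇒≡ eq)

    -- The third root is r₁ + r₃, so this is Vieta's relation for the coefficient of X; `product≡a`
    -- is the one for the constant term.
    quadratic : r₁ * r₁ + r₁ * r₃ + r₃ * r₃ + 1# ≡ 0#
    quadratic = x*y≡0 (trans
      (solve 3 (λ r₁ r₃ a → (r₁ :+ r₃) :* (r₁ :* r₁ :+ r₁ :* r₃ :+ r₃ :* r₃ :+ :1)
        := (r₁ :^ 3 :+ r₁ :+ a) :+ (r₃ :^ 3 :+ r₃ :+ a)) refl r₁ r₃ a)
      (trans (cong₂ _+_ r₁-root r₃-root) (+-identityˡ 0#))) r₁+r₃≢0

    product≡a : r₁ * r₃ * (r₁ + r₃) ≡ a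
    product≡a = +≡0⇒≡ (trans
      (solve 3 (λ r₁ r₃ a → r₁ :* r₃ :* (r₁ :+ r₃) :+ a
        := (r₁ :^ 3 :+ r₁ :+ a) :+ r₁ :* (r₁ :* r₁ :+ r₁ :* r₃ :+ r₃ :* r₃ :+ :1)) refl r₁ r₃ a)
      (trans (cong₂ (λ u v → u + r₁ * v) r₁-root quadratic) (solve 1 (λ r → :0 :+ r :* :0 := :0) refl r₁)))

    r₁≢0 : r₁ ≢ 0#
    r₁≢0 eq = a≢0 (trans (sym product≡a) (trans (cong (λ r → r * r₃ * (r + r₃)) eq)
        (solve 1 (λ r → :0 :* r :* (:0 :+ r) := :0) refl r₃)))

    r₃≢0 : r₃ ≢ 0#
    r₃≢0 eq = a≢0 (trans (sym product≡a) (trans (cong (λ r → r₁ * r * (r₁ + r)) eq)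
        (solve 1 (λ r → r :* :0 :* (r :+ :0) := :0) refl r₁)))

    -- The inverse of the coordinate s: the Möbius map taking 0, 1, ∞ to r₁, r₁ + r₃, r₃. Its
    -- determinant is r₁ r₃ (r₁ + r₃) = a.
    num den point : C → C
    num s = s * (r₃ * r₃) + r₁ * r₁
    den s = s * r₃ + r₁
    point s = num s * (den s) ⁻¹

    point*den : ∀ {s} → den s ≢ 0# → point s * den s ≡ num s
    point*den {s} den≢0 = begin
      num s * den s ⁻¹ * den s      ≡⟨ solve 3 (λ n d i → n :* i :* d := n :* (d :* i))
          refl (num s) (den s) (den s ⁻¹) ⟩
      num s * (den s * den s ⁻¹)    ≡⟨ cong (num s *_) (inverseʳ (den s) den≢0) ⟩
      num s * 1#                    ≡⟨ *-identityʳ _ ⟩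
      num s                         ∎
      where open ≡-Reasoning

    point-unique : ∀ {s x} → den s ≢ 0# → x * den s ≡ num s → x ≡ point s
    point-unique {s} {x} den≢0 eq = *-cancelˡ den≢0
        (trans (*-comm _ _) (trans eq (sym (trans (*-comm _ _) (point*den den≢0)))))

    point≢r₃ : ∀ {s} → den s ≢ 0# → point s ≢ r₃
    point≢r₃ {s} den≢0 eq = *-≢0 r₁≢0 r₁+r₃≢0 (trans
      (solve 3 (λ s r₁ r₃ → r₁ :* (r₁ :+ r₃) := (s :* (r₃ :* r₃) :+ r₁ :* r₁) :+ r₃ :* (s :* r₃ :+ r₁)) refl s r₁ r₃)
      (≡⇒+≡0 (trans (sym (point*den den≢0)) (cong (_* den s) eq))))

    point-injective : ∀ {s t} → den s ≢ 0# → den t ≢ 0# → point s ≡ point t → s ≡ t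
    point-injective {s} {t} den-s≢0 den-t≢0 eq = +≡0⇒≡ (x*y≡0 (begin
      r₁ * r₃ * (r₁ + r₃) * (s + t)
        ≡⟨ solve 4 (λ s t r₁ r₃ → r₁ :* r₃ :* (r₁ :+ r₃) :* (s :+ t)
             := (s :* (r₃ :* r₃) :+ r₁ :* r₁) :* (t :* r₃ :+ r₁) :+ (t :* (r₃ :* r₃) :+ r₁ :* r₁) :* (s :* r₃ :+ r₁)) refl s t r₁ r₃ ⟩
      num s * den t + num t * den s
        ≡⟨ cong₂ (λ u v → u * den t + v * den s) (point*den den-s≢0) (point*den den-t≢0) ⟨
      point s * den s * den t + point t * den t * den s
        ≡⟨ cong (λ u → u * den s * den t + point t * den t * den s) eq ⟩
      point t * den s * den t + point t * den t * den s
        ≡⟨ solve 3 (λ p u v → p :* u :* v :+ p :* v :* u := :0) refl (point t) (den s) (den t) ⟩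
      0# ∎) (λ prod≡0 → a≢0 (trans (sym product≡a) prod≡0)))
      where open ≡-Reasoning

    parameter : ∀ {x} → x ≢ r₃ → ∃ λ s → den s ≢ 0# × x ≡ point s
    parameter {x} x≢r₃ = s , den≢0 , point-unique den≢0 x*den
      where
      t = (x + r₃) * r₃
      t≢0 : t ≢ 0#
      t≢0 = *-≢0 (λ eq → x≢r₃ (+≡0⇒≡ eq)) r₃≢0
      s = (x + r₁) * r₁ * t ⁻¹
      s*t : s * t ≡ (x + r₁) * r₁
      s*t = trans (solve 3 (λ n t i → n :* i :* t := n :* (t :* i)) refl ((x + r₁) * r₁) t (t ⁻¹))
        (trans (cong ((x + r₁) * r₁ *_) (inverseʳ t t≢0)) (*-identityʳ _))
      x*den : x * den s ≡ num s
      x*den = +≡0⇒≡ (trans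
        (solve 4 (λ x s r₁ r₃ → x :* (s :* r₃ :+ r₁) :+ (s :* (r₃ :* r₃) :+ r₁ :* r₁)
            := s :* ((x :+ r₃) :* r₃) :+ (x :+ r₁) :* r₁) refl x s r₁ r₃)
        (≡⇒+≡0 s*t))
      den≢0 : den s ≢ 0#
      den≢0 eq = *-≢0 r₁≢0 r₁+r₃≢0 (trans
        (solve 4 (λ x s r₁ r₃ → r₁ :* (r₁ :+ r₃) := (x :+ r₃) :* (s :* r₃ :+ r₁) :+ (s :* ((x :+ r₃) :* r₃) :+ (x :+ r₁) :* r₁)) refl x s r₁ r₃)
        (trans (cong₂ (λ u v → (x + r₃) * u + v) eq (≡⇒+≡0 s*t)) (solve 1 (λ u → u :* :0 :+ :0 := :0) refl _)))

    -- ∞ is not periodic of period 3 under x ↦ a/(x + 1)², as a ≠ 1.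
    den≢0-on-𝔽₈ : ∀ {s} → s ^ 8 ≡ s → den s ≢ 0#
    den≢0-on-𝔽₈ {s} s⁸≡s den≡0 = a≢1 (square-injective (begin
      a * a
        ≡⟨ cong (λ t → t * t) a≡ ⟩
      g * (ρ * r₃) * (g * (ρ * r₃))
        ≡⟨ solve 2 (λ g r → g :* (r :* r :* r) :* (g :* (r :* r :* r))
            := g :* g :* (r :* r :* (r :* r) :* (r :* r))) refl g r₃ ⟩
      g * g * (ρ * ρ * ρ)
        -- This rests on (g + 1)³ = (g³ + g + 1) + g²: the first summand vanishes for g and ρ (g +
        -- 1) is 1.
        ≡⟨ solve 2 (λ g ρ → g :* g :* (ρ :* ρ :* ρ)
            := ρ :* ρ :* ρ :* (g :* g :* g :+ g :+ :1) :+ ρ :* (g :+ :1) :* (ρ :* (g :+ :1)) :* (ρ :* (g :+ :1)))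
            refl g ρ ⟩
      ρ * ρ * ρ * (g * g * g + g + 1#) + ρ * (g + 1#) * (ρ * (g + 1#)) * (ρ * (g + 1#))
        ≡⟨ cong₂ (λ u v → ρ * ρ * ρ * u + v * v * v) Ψ≡0 κ≡1 ⟩
      ρ * ρ * ρ * 0# + 1# * 1# * 1#
        ≡⟨ solve 1 (λ u → u :* :0 :+ :1 :* :1 :* :1 := :1 :* :1) refl _ ⟩
      1# * 1# ∎))
      where
      open ≡-Reasoning
      g = s * s + s
      ρ = r₃ * r₃
      r₁≡ : r₁ ≡ s * r₃
      r₁≡ = sym (+≡0⇒≡ den≡0)
      a≡ : a ≡ g * (ρ * r₃)
      a≡ = begin
        a                                   ≡⟨ product≡a ⟨
        r₁ * r₃ * (r₁ + r₃)                 ≡⟨ cong (λ r → r * r₃ * (r + r₃)) r₁≡ ⟩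
        s * r₃ * r₃ * (s * r₃ + r₃)         ≡⟨ solve 2
            (λ s r → s :* r :* r :* (s :* r :+ r) := (s :* s :+ s) :* (r :* r :* r)) refl s r₃ ⟩
        g * (ρ * r₃)                        ∎
      g≢0 : g ≢ 0#
      g≢0 g≡0 = a≢0 (trans a≡ (trans (cong (_* (ρ * r₃)) g≡0) (zeroˡ _)))
      -- For g = s² + s the sum g + g² + g⁴ telescopes to s⁸ + s.
      Ψ≡0 : g * g * g + g + 1# ≡ 0#
      Ψ≡0 = x*y≡0 (trans
        (solve 1 (λ s → let g = s :* s :+ s in g :* (g :* g :* g :+ g :+ :1) := s :^ 8 :+ s) refl s)
        (≡⇒+≡0 s⁸≡s)) g≢0
      κ≡1 : ρ * (g + 1#) ≡ 1#
      κ≡1 = +≡0⇒≡ (trans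
        (solve 2 (λ s r → r :* r :* (s :* s :+ s :+ :1) :+ :1
            := s :* r :* (s :* r) :+ s :* r :* r :+ r :* r :+ :1) refl s r₃)
        (trans (cong (λ t → t * t + t * r₃ + r₃ * r₃ + 1#) (sym r₁≡)) quadratic))

    -- For u = σ r₃, v = σ r₁ and τ = σ s, the left-hand side is x (σ x + 1)² + b,
    -- up to the denominators of x = point s and of σ x.
    Descends : (b u v : C) → (C → C → C) → Set
    Descends b u v P = ∀ s τ → let N = τ * (u * u) + v * v ; D = τ * u + v in
      num s * (N * N + D * D) + b * (den s * (D * D)) ≡ b * (b * P s τ)

    -- This collects what does not depend on how σ permutes the roots of the cubic. P is the
    -- equation x = φ(σ x) written in the coordinates s and τ = σ s, and `P⇒𝔽₈` confines its
    -- solutions to finitely many known parameters.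
    module RootCount
      (j : ℕ) (P : C → C → C) (P-descends : Descends a (r₃ ^ (2 ℕ.^ j)) (r₁ ^ (2 ℕ.^ j)) P)
      (P⇒𝔽₈ : ∀ s → P s (s ^ (2 ℕ.^ j)) ≡ 0# → s ^ 8 ≡ s)
      where

      σ f : C → C
      σ x = x ^ (2 ℕ.^ j)
      f x = x * (σ x * σ x) + x + a

      module _ {s : C} (den≢0 : den s ≢ 0#) where
        private
          x = point s
          u = σ r₃
          v = σ r₁
          D = σ s * u + v
          N = σ s * (u * u) + v * v

          σ-* : ∀ x y → σ (x * y) ≡ σ x * σ y
          σ-* x y = ^-distrib-* x y (2 ℕ.^ j)

          σ-den : σ (den s) ≡ D
          σ-den = trans (frobenius-+ j (s * r₃) r₁) (cong (_+ v) (σ-* s r₃))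

          σ-num : σ (num s) ≡ N
          σ-num = trans (frobenius-+ j (s * (r₃ * r₃)) (r₁ * r₁))
            (cong₂ _+_ (trans (σ-* s (r₃ * r₃)) (cong (σ s *_) (σ-* r₃ r₃))) (σ-* r₁ r₁))

          D≢0 : D ≢ 0#
          D≢0 D≡0 = ^-≢0 (2 ℕ.^ j) den≢0 (trans σ-den D≡0)

          σx*D : σ x * D ≡ N
          σx*D = begin
            σ x * D           ≡⟨ cong (σ x *_) σ-den ⟨
            σ x * σ (den s)   ≡⟨ σ-* x (den s) ⟨
            σ (x * den s)     ≡⟨ cong σ (point*den den≢0) ⟩
            σ (num s)         ≡⟨ σ-num ⟩
            N                 ∎
            where open ≡-Reasoning

          scaled : den s * (D * D) * f x ≡ a * (a * P s (σ s))
          scaled = begin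
            den s * (D * D) * (x * (σ x * σ x) + x + a)
              ≡⟨ solve 5 (λ d D x y a → d :* (D :* D) :* (x :* (y :* y) :+ x :+ a)
                   := x :* d :* (y :* D :* (y :* D) :+ D :* D) :+ a :* (d :* (D :* D))) refl (den s) D x (σ x) a ⟩
            x * den s * (σ x * D * (σ x * D) + D * D) + a * (den s * (D * D))
              ≡⟨ cong₂ (λ n N → n * (N * N + D * D) + a * (den s * (D * D))) (point*den den≢0) σx*D ⟩
            num s * (N * N + D * D) + a * (den s * (D * D))
              ≡⟨ P-descends s (σ s) ⟩
            a * (a * P s (σ s)) ∎
            where open ≡-Reasoning

        root⇒P : f (point s) ≡ 0# → P s (σ s) ≡ 0#
        root⇒P fx≡0 = x*y≡0 (x*y≡0 (trans (sym scaled) (trans (cong (den s * (D * D) *_) fx≡0) (zeroʳ _))) a≢0) a≢0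

        P⇒root : P s (σ s) ≡ 0# → f (point s) ≡ 0#
        P⇒root P≡0 = x*y≡0 (trans scaled (trans (cong (λ t → a * (a * t)) P≡0)
            (solve 1 (λ a → a :* (a :* :0) := :0) refl a)))
          (*-≢0 den≢0 (*-≢0 D≢0 D≢0))

      -- S holds only finite parameters. The point r₃ has s = ∞ and is counted apart.
      record Parameters (S : List C) : Set where
        field
          unique   : Unique S
          in-𝔽₈    : ∀ {s} → s ∈ S → s ^ 8 ≡ s
          sound    : ∀ {s} → s ∈ S → P s (σ s) ≡ 0#
          complete : ∀ {s} → s ^ 8 ≡ s → P s (σ s) ≡ 0# → s ∈ S

      module _ {S : List C} (params : Parameters S) where
        open Parameters params

        private
          den≢0 : ∀ {s} → s ∈ S → den s ≢ 0#
          den≢0 s∈S = den≢0-on-𝔽₈ (in-𝔽₈ s∈S)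

          points-unique : Unique (map point S)
          points-unique = Unique-map-on (λ s → den s ≢ 0#) point-injective (All.tabulate den≢0) unique

          points-sound : ∀ x → x ∈ map point S → f x ≡ 0#
          points-sound x x∈ with s , s∈S , refl ← ∈-map⁻ point x∈ = P⇒root (den≢0 s∈S) (sound s∈S)

          points-complete : ∀ x → x ≢ r₃ → f x ≡ 0# → x ∈ map point S
          points-complete x x≢r₃ fx≡0 = from-parameter (parameter x≢r₃)
            where
            from-parameter : (∃ λ s → den s ≢ 0# × x ≡ point s) → x ∈ map point S
            from-parameter (s , d≢0 , x≡) = subst (_∈ map point S) (sym x≡) (∈-map⁺ point (complete (P⇒𝔽₈ s P≡0) P≡0))
              where
              P≡0 : P s (σ s) ≡ 0#
              P≡0 = root⇒P d≢0 (trans (cong f (sym x≡)) fx≡0)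

        count-without-r₃ : f r₃ ≢ 0# → numRoots f ≡ length S
        count-without-r₃ fr₃≢0 = trans
          (numRoots≡length f (map point S) points-unique points-sound
            (λ x fx≡0 → points-complete x (λ x≡r₃ → fr₃≢0 (trans (cong f (sym x≡r₃)) fx≡0)) fx≡0))
          (length-map point S)

        count-with-r₃ : f r₃ ≡ 0# → numRoots f ≡ suc (length S)
        count-with-r₃ fr₃≡0 = trans
          (numRoots≡length f (r₃ ∷ map point S) (All.tabulate r₃∉ ∷ points-unique)
            (λ { x (here refl) → fr₃≡0 ; x (there x∈) → points-sound x x∈ }) complete′)
          (cong suc (length-map point S))
          where
          r₃∉ : ∀ {x} → x ∈ map point S → r₃ ≢ x
          r₃∉ x∈ r₃≡x with s , s∈S , x≡ ← ∈-map⁻ point x∈ = point≢r₃ (den≢0 s∈S) (sym (trans r₃≡x x≡))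
          complete′ : ∀ x → f x ≡ 0# → x ∈ r₃ ∷ map point S
          complete′ x fx≡0 with x ≟ r₃
          ... | yes x≡r₃ = here x≡r₃
          ... | no  x≢r₃ = there (points-complete x x≢r₃ fx≡0)

-- Residues modulo 3

residue : ∀ i → (∃ λ k → i ≡ k ℕ.* 3) ⊎ (∃ λ k → i ≡ 1 ℕ.+ k ℕ.* 3) ⊎ (∃ λ k → i ≡ 2 ℕ.+ k ℕ.* 3)
residue zero    = inj₁ (0 , refl)
residue (suc i) with residue i
... | inj₁ (k , eq)        = inj₂ (inj₁ (k , cong suc eq))
... | inj₂ (inj₁ (k , eq)) = inj₂ (inj₂ (k , cong suc eq))
... | inj₂ (inj₂ (k , eq)) = inj₁ (suc k , cong suc eq)

nonzero-residue : ∀ {i} → ¬ (3 ∣ i) → (∃ λ k → i ≡ 1 ℕ.+ k ℕ.* 3) ⊎ (∃ λ k → i ≡ 2 ℕ.+ k ℕ.* 3)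
nonzero-residue {i} 3∤i with residue i
... | inj₁ (k , eq) = contradiction (divides k eq) 3∤i
... | inj₂ r        = r

private
  3∤ : ∀ {i} k r → 0 ℕ.< r → r ℕ.< 3 → i ≡ k ℕ.* 3 ℕ.+ r → ¬ (3 ∣ i)
  3∤ k (suc r) _ r<3 refl 3∣i = >⇒∤ r<3 (∣m+n∣m⇒∣n 3∣i (divides k refl))

-- From ℓ² ≡ 1 modulo 3 it follows that mℓ ≡ 2 exactly when m ≡ -ℓ. The product mℓ matters because σ
-- is the 2^(mℓ)-th power map, which acts on 𝔽₈ through mℓ modulo 3.
product-residue : ∀ {ℓ m} → ¬ (3 ∣ ℓ) →
    (3 ∣ ℓ ℕ.+ m × ∃ λ t → m ℕ.* ℓ ≡ 2 ℕ.+ t ℕ.* 3)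
  ⊎ (¬ (3 ∣ ℓ ℕ.+ m) × ((∃ λ t → m ℕ.* ℓ ≡ t ℕ.* 3) ⊎ (∃ λ t → m ℕ.* ℓ ≡ 1 ℕ.+ t ℕ.* 3)))
product-residue {ℓ} {m} 3∤ℓ with nonzero-residue 3∤ℓ | residue m
... | inj₁ (k , refl) | inj₁ (l , refl) = inj₂
  ( 3∤ (k ℕ.+ l) 1 ℕ.z<s (ℕ.s<s ℕ.z<s) (ℕsolve 2 (λ k l → (κ 1 ⊕ k ⊗ κ 3) ⊕ l ⊗ κ 3 ⊜ (k ⊕ l) ⊗ κ 3 ⊕ κ 1) refl k l)
  , inj₁ (l ℕ.* (1 ℕ.+ k ℕ.* 3) , ℕsolve 2 (λ k l → l ⊗ κ 3 ⊗ (κ 1 ⊕ k ⊗ κ 3) ⊜ l ⊗ (κ 1 ⊕ k ⊗ κ 3) ⊗ κ 3) refl k l))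
... | inj₁ (k , refl) | inj₂ (inj₁ (l , refl)) = inj₂
  ( 3∤ (k ℕ.+ l) 2 ℕ.z<s (ℕ.s<s (ℕ.s<s ℕ.z<s)) (ℕsolve 2
      (λ k l → (κ 1 ⊕ k ⊗ κ 3) ⊕ (κ 1 ⊕ l ⊗ κ 3) ⊜ (k ⊕ l) ⊗ κ 3 ⊕ κ 2) refl k l)
  , inj₂ (k ℕ.+ l ℕ.+ l ℕ.* k ℕ.* 3 , ℕsolve 2 (λ k l → (κ 1 ⊕ l ⊗ κ 3) ⊗ (κ 1 ⊕ k ⊗ κ 3)
      ⊜ κ 1 ⊕ (k ⊕ l ⊕ l ⊗ k ⊗ κ 3) ⊗ κ 3) refl k l))
... | inj₁ (k , refl) | inj₂ (inj₂ (l , refl)) = inj₁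
  ( divides (1 ℕ.+ k ℕ.+ l) (ℕsolve 2 (λ k l → (κ 1 ⊕ k ⊗ κ 3) ⊕ (κ 2 ⊕ l ⊗ κ 3) ⊜ (κ 1 ⊕ k ⊕ l) ⊗ κ 3) refl k l)
  , 2 ℕ.* k ℕ.+ l ℕ.+ l ℕ.* k ℕ.* 3 , ℕsolve 2 (λ k l → (κ 2 ⊕ l ⊗ κ 3) ⊗ (κ 1 ⊕ k ⊗ κ 3)
      ⊜ κ 2 ⊕ (κ 2 ⊗ k ⊕ l ⊕ l ⊗ k ⊗ κ 3) ⊗ κ 3) refl k l)
... | inj₂ (k , refl) | inj₁ (l , refl) = inj₂
  ( 3∤ (k ℕ.+ l) 2 ℕ.z<s (ℕ.s<s (ℕ.s<s ℕ.z<s)) (ℕsolve 2 (λ k l → (κ 2 ⊕ k ⊗ κ 3) ⊕ l ⊗ κ 3 ⊜ (k ⊕ l) ⊗ κ 3 ⊕ κ 2)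
      refl k l)
  , inj₁ (l ℕ.* (2 ℕ.+ k ℕ.* 3) , ℕsolve 2 (λ k l → l ⊗ κ 3 ⊗ (κ 2 ⊕ k ⊗ κ 3) ⊜ l ⊗ (κ 2 ⊕ k ⊗ κ 3) ⊗ κ 3) refl k l))
... | inj₂ (k , refl) | inj₂ (inj₁ (l , refl)) = inj₁
  ( divides (1 ℕ.+ k ℕ.+ l) (ℕsolve 2 (λ k l → (κ 2 ⊕ k ⊗ κ 3) ⊕ (κ 1 ⊕ l ⊗ κ 3) ⊜ (κ 1 ⊕ k ⊕ l) ⊗ κ 3) refl k l)
  , k ℕ.+ 2 ℕ.* l ℕ.+ l ℕ.* k ℕ.* 3 , ℕsolve 2 (λ k l → (κ 1 ⊕ l ⊗ κ 3) ⊗ (κ 2 ⊕ k ⊗ κ 3)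
      ⊜ κ 2 ⊕ (k ⊕ κ 2 ⊗ l ⊕ l ⊗ k ⊗ κ 3) ⊗ κ 3) refl k l)
... | inj₂ (k , refl) | inj₂ (inj₂ (l , refl)) = inj₂
  ( 3∤ (1 ℕ.+ k ℕ.+ l) 1 ℕ.z<s (ℕ.s<s ℕ.z<s) (ℕsolve 2
      (λ k l → (κ 2 ⊕ k ⊗ κ 3) ⊕ (κ 2 ⊕ l ⊗ κ 3) ⊜ (κ 1 ⊕ k ⊕ l) ⊗ κ 3 ⊕ κ 1) refl k l)
  , inj₂ (1 ℕ.+ 2 ℕ.* k ℕ.+ 2 ℕ.* l ℕ.+ l ℕ.* k ℕ.* 3 , ℕsolve 2
      (λ k l → (κ 2 ⊕ l ⊗ κ 3) ⊗ (κ 2 ⊕ k ⊗ κ 3) ⊜ κ 1 ⊕ (κ 1 ⊕ κ 2 ⊗ k ⊕ κ 2 ⊗ l ⊕ l ⊗ k ⊗ κ 3) ⊗ κ 3) refl k l))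

-- Root counts when σ fixes or cyclically permutes the roots of the cubic

module FrobeniusOn𝔽₈ {e : ℕ} (K : GF2Field e) where
  open GF2Field K hiding (dickson) renaming (Carrier to C)
  open FiniteField K

  module _ {s : C} (s⁸≡s : s ^ 8 ≡ s) where
    frobenius-0-mod-3 : ∀ {j} t → j ≡ t ℕ.* 3 → s ^ (2 ℕ.^ j) ≡ s
    frobenius-0-mod-3 zero    refl = *-identityʳ s
    frobenius-0-mod-3 (suc t) refl = begin
      s ^ (2 ℕ.^ (3 ℕ.+ t ℕ.* 3))   ≡⟨ cong (s ^_) (ℕₚ.^-distribˡ-+-* 2 3 (t ℕ.* 3)) ⟩
      s ^ (8 ℕ.* 2 ℕ.^ (t ℕ.* 3))   ≡⟨ ^-assocʳ s 8 (2 ℕ.^ (t ℕ.* 3)) ⟨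
      (s ^ 8) ^ (2 ℕ.^ (t ℕ.* 3))   ≡⟨ cong (_^ (2 ℕ.^ (t ℕ.* 3))) s⁸≡s ⟩
      s ^ (2 ℕ.^ (t ℕ.* 3))         ≡⟨ frobenius-0-mod-3 t refl ⟩
      s                             ∎
      where open ≡-Reasoning

    frobenius-1-mod-3 : ∀ {j} t → j ≡ 1 ℕ.+ t ℕ.* 3 → s ^ (2 ℕ.^ j) ≡ s * s
    frobenius-1-mod-3 t refl = trans (^-2^suc s (t ℕ.* 3)) (cong (λ u → u * u) (frobenius-0-mod-3 t refl))

    frobenius-2-mod-3 : ∀ {j} t → j ≡ 2 ℕ.+ t ℕ.* 3 → s ^ (2 ℕ.^ j) ≡ s * s * (s * s)
    frobenius-2-mod-3 t refl = trans (^-2^suc s (1 ℕ.+ t ℕ.* 3)) (cong (λ u → u * u) (frobenius-1-mod-3 t refl))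

module RootCounts {e : ℕ} (K : GF2Field e) where
  open GF2Field K hiding (dickson) renaming (Carrier to C)
  open FiniteField K
  open FrobeniusOn𝔽₈ K
  open Subfield₈ K
  open Points K

  module _
    (a r₁ r₃ : C) (a≢0 : a ≢ 0#) (a≢1 : a ≢ 1#)
    (r₁-root : r₁ ^ 3 + r₁ + a ≡ 0#) (r₃-root : r₃ ^ 3 + r₃ + a ≡ 0#) (r₁≢r₃ : r₁ ≢ r₃)
    (j : ℕ) (σ³≡id : ∀ x → ((x ^ (2 ℕ.^ j)) ^ (2 ℕ.^ j)) ^ (2 ℕ.^ j) ≡ x)
    {w : C} (αw≡0 : α w ≡ 0#)
    where

    open Parametrization a r₁ r₃ a≢0 a≢1 r₁-root r₃-root r₁≢r₃

    private
      σ f : C → C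
      σ x = x ^ (2 ℕ.^ j)
      f x = x * (σ x * σ x) + x + a

      σ-* : ∀ x y → σ (x * y) ≡ σ x * σ y
      σ-* x y = ^-distrib-* x y (2 ℕ.^ j)

      σ-+ : ∀ x y → σ (x + y) ≡ σ x + σ y
      σ-+ = frobenius-+ j

      σ-0 : σ 0# ≡ 0#
      σ-0 = trans (cong σ (sym (double 0#))) (trans (σ-+ 0# 0#) (double _))

      -- The solver treats r₁ and r₃ as independent, so identities that hold only modulo `quadratic`
      -- are passed to it with an explicit cofactor c.
      reduce : ∀ {y z} c → y ≡ z + c * (r₁ * r₁ + r₁ * r₃ + r₃ * r₃ + 1#) → y ≡ z
      reduce c eq = trans eq (trans (cong (λ t → _ + c * t) quadratic) (solve 2 (λ z c → z :+ c :* :0 := z) refl _ c))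

    module RootsFixed (σr₁≡r₁ : σ r₁ ≡ r₁) (σr₃≡r₃ : σ r₃ ≡ r₃) where

      private
        -- σ fixes the points 0, 1, ∞ of the coordinate, so σ x has coordinate τ and x = φ(σ x)
        -- reads s = τ².
        P : C → C → C
        P s τ = s + τ * τ

        P-descends : ∀ u v A → u ≡ r₃ → v ≡ r₁ → r₁ * r₃ * (r₁ + r₃) ≡ A → Descends A u v P
        -- Modulo `quadratic`, the factors r₃² + 1 and r₁² + 1 occurring in N² + D² equal r₁ (r₁ +
        -- r₃) and r₃ (r₁ + r₃); the cofactor collects these two replacements.
        P-descends _ _ _ refl refl refl s τ = reduce ((s * (r₃ * r₃) + r₁ * r₁) * (τ * τ * (r₃ * r₃) + r₁ * r₁))
          (solve 4 (λ r₁ r₃ s τ → let N = τ :* (r₃ :* r₃) :+ r₁ :* r₁ ; D = τ :* r₃ :+ r₁ ; A = r₁ :* r₃ :* (r₁ :+ r₃)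
                                      n = s :* (r₃ :* r₃) :+ r₁ :* r₁ ; d = s :* r₃ :+ r₁ in
             n :* (N :* N :+ D :* D) :+ A :* (d :* (D :* D))
             := A :* (A :* (s :+ τ :* τ)) :+ n :* (τ :* τ :* (r₃ :* r₃) :+ r₁ :* r₁) :* (r₁ :* r₁ :+ r₁ :* r₃ :+ r₃ :* r₃ :+ :1))
             refl r₁ r₃ s τ)

        -- Applying σ to s = (σ s)² twice and using σ³ = id closes a cycle of three squarings.
        P⇒𝔽₈ : ∀ s → P s (σ s) ≡ 0# → s ^ 8 ≡ s
        P⇒𝔽₈ s P≡0 = sym (begin
          s                                 ≡⟨ s≡τ² ⟩
          τ * τ                             ≡⟨ cong (λ t → t * t) τ≡ρ² ⟩
          ρ * ρ * (ρ * ρ)                   ≡⟨ cong (λ t → t * t * (t * t)) ρ≡s² ⟩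
          s * s * (s * s) * (s * s * (s * s)) ≡⟨ solve 1
              (λ s → s :* s :* (s :* s) :* (s :* s :* (s :* s)) := s :^ 8) refl s ⟩
          s ^ 8                             ∎)
          where
          open ≡-Reasoning
          τ = σ s
          ρ = σ τ
          s≡τ² : s ≡ τ * τ
          s≡τ² = +≡0⇒≡ P≡0
          τ≡ρ² : τ ≡ ρ * ρ
          τ≡ρ² = trans (cong σ s≡τ²) (σ-* τ τ)
          ρ≡s² : ρ ≡ s * s
          ρ≡s² = trans (cong σ τ≡ρ²) (trans (σ-* ρ ρ) (cong (λ t → t * t) (σ³≡id s)))

      open RootCount j P (P-descends (σ r₃) (σ r₁) a σr₃≡r₃ σr₁≡r₁ product≡a) P⇒𝔽₈ hiding (f; σ)

      private
        fr₃≡0 : f r₃ ≡ 0#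
        fr₃≡0 = trans (cong (λ t → r₃ * (t * t) + r₃ + a) σr₃≡r₃)
          (trans (solve 2 (λ r a → r :* (r :* r) :+ r :+ a := r :^ 3 :+ r :+ a) refl r₃ a) r₃-root)

        three : (∀ {s} → s ^ 8 ≡ s → P s (σ s) ≡ 0# → s * (s + 1#) ≡ 0#) → numRoots f ≡ 3
        three P⇒𝔽₂ = count-with-r₃ (record
          { unique   = 𝔽₂-unique αw≡0
          ; in-𝔽₈    = 𝔽₂-in-𝔽₈ αw≡0
          ; sound    = λ { (here refl) → trans (cong (λ t → 0# + t * t) σ-0) (solve 0 (:0 :+ :0 :* :0 := :0) refl)
                         ; (there (here refl)) → trans (cong (λ t → 1# + t * t) (1^ (2 ℕ.^ j)))
                             (solve 0 (:1 :+ :1 :* :1 := :0) refl) }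
          ; complete = λ s⁸≡s P≡0 → [ here , (λ s+1≡0 → there (here (+≡0⇒≡ s+1≡0))) ]′ (x*y≡0⇒ (P⇒𝔽₂ s⁸≡s P≡0))
          }) fr₃≡0

      count-0-mod-3 : ∀ t → j ≡ t ℕ.* 3 → numRoots f ≡ 3
      count-0-mod-3 t j≡ = three (λ {s} s⁸≡s P≡0 → trans (solve 1 (λ s → s :* (s :+ :1) := s :+ s :* s) refl s)
        (subst (λ u → s + u * u ≡ 0#) (frobenius-0-mod-3 s⁸≡s t j≡) P≡0))

      count-1-mod-3 : ∀ t → j ≡ 1 ℕ.+ t ℕ.* 3 → numRoots f ≡ 3
      count-1-mod-3 t j≡ = three (λ {s} s⁸≡s P≡0 → begin
        s * (s + 1#)
          -- Here s + s⁴ = 0; its square s² + s⁸ becomes s² + s on 𝔽₈.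
          ≡⟨ solve 1 (λ s → s :* (s :+ :1) := (s :+ s :* s :* (s :* s)) :^ 2 :+ (s :^ 8 :+ s)) refl s ⟩
        (s + s * s * (s * s)) ^ 2 + (s ^ 8 + s)
          ≡⟨ cong₂ (λ u v → u ^ 2 + v) (subst (λ u → s + u * u ≡ 0#) (frobenius-1-mod-3 s⁸≡s t j≡) P≡0) (≡⇒+≡0 s⁸≡s) ⟩
        0# ^ 2 + 0#
          ≡⟨ solve 0 (:0 :^ 2 :+ :0 := :0) refl ⟩
        0# ∎)
        where open ≡-Reasoning

      count-2-mod-3 : ∀ t → j ≡ 2 ℕ.+ t ℕ.* 3 → numRoots f ≡ 9
      count-2-mod-3 t j≡ = count-with-r₃ (record
        { unique   = 𝔽₈-unique αw≡0
        ; in-𝔽₈    = 𝔽₈-sound αw≡0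
        ; sound    = λ {s} s∈ → let s⁸≡s = 𝔽₈-sound αw≡0 s∈ in
            trans (cong (λ u → s + u * u) (frobenius-2-mod-3 s⁸≡s t j≡))
            (trans (solve 1 (λ s → s :+ s :* s :* (s :* s) :* (s :* s :* (s :* s)) := s :^ 8 :+ s) refl s)
                (≡⇒+≡0 s⁸≡s))
        ; complete = λ s⁸≡s _ → 𝔽₈-complete αw≡0 s⁸≡s
        }) fr₃≡0

    module RootsCycled (σr₃≡r₁ : σ r₃ ≡ r₁) (σr₁≡r₁+r₃ : σ r₁ ≡ r₁ + r₃) where

      private
        -- σ sends r₁ to r₂ = r₁ + r₃, r₂ to r₃ and r₃ to r₁, so the coordinate of σ x is 1/(τ + 1),
        -- the Möbius map taking 0, 1, ∞ to 1, ∞, 0. Hence s = 1/(τ + 1)².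
        P : C → C → C
        P s τ = s * (τ * τ) + s + 1#

        P-descends : ∀ u v A → u ≡ r₁ → v ≡ r₁ + r₃ → r₁ * r₃ * (r₁ + r₃) ≡ A → Descends A u v P
        P-descends _ _ _ refl refl refl s τ = reduce ((s * (r₃ * r₃) + r₁ * r₁) * (τ * τ * (r₁ * r₁) + (r₁ + r₃) * (r₁ + r₃)))
          (solve 4 (λ r₁ r₃ s τ → let N = τ :* (r₁ :* r₁) :+ (r₁ :+ r₃) :* (r₁ :+ r₃) ; D = τ :* r₁ :+ (r₁ :+ r₃) ; A = r₁ :* r₃ :* (r₁ :+ r₃)
                                      n = s :* (r₃ :* r₃) :+ r₁ :* r₁ ; d = s :* r₃ :+ r₁ in
             n :* (N :* N :+ D :* D) :+ A :* (d :* (D :* D))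
             := A :* (A :* (s :* (τ :* τ) :+ s :+ :1))
                :+ n :* (τ :* τ :* (r₁ :* r₁) :+ (r₁ :+ r₃) :* (r₁ :+ r₃)) :* (r₁ :* r₁ :+ r₁ :* r₃ :+ r₃ :* r₃ :+ :1))
             refl r₁ r₃ s τ)

        σ-P : ∀ x y → P x y ≡ 0# → P (σ x) (σ y) ≡ 0#
        σ-P x y eq = begin
          σ x * (σ y * σ y) + σ x + 1#    ≡⟨ cong₂ (λ u v → u + σ x + v)
              (trans (σ-* x (y * y)) (cong (σ x *_) (σ-* y y))) (1^ (2 ℕ.^ j)) ⟨
          σ (x * (y * y)) + σ x + σ 1#    ≡⟨ cong (_+ σ 1#) (σ-+ (x * (y * y)) x) ⟨
          σ (x * (y * y) + x) + σ 1#      ≡⟨ σ-+ (x * (y * y) + x) 1# ⟨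
          σ (P x y)                       ≡⟨ cong σ eq ⟩
          σ 0#                            ≡⟨ σ-0 ⟩
          0#                              ∎
          where open ≡-Reasoning

        P⇒𝔽₈ : ∀ s → P s (σ s) ≡ 0# → s ^ 8 ≡ s
        P⇒𝔽₈ s P≡0 = +≡0⇒≡ (begin
          s ^ 8 + s
            ≡⟨ solve 2 (λ s y → s :^ 8 :+ s := (s :* (y :* y) :+ s :+ :1) :* s :^ 8
                 :+ s :* ((y :* s :^ 4 :+ (s :+ :1) :^ 4) :* (y :* s :^ 4 :+ (s :+ :1) :^ 4))) refl s y ⟩
          P s y * s ^ 8 + s * (W * W)
            ≡⟨ cong₂ (λ u v → u * s ^ 8 + s * (v * v)) P≡0 W≡0 ⟩
          0# * s ^ 8 + s * (0# * 0#)
            ≡⟨ solve 2 (λ u v → :0 :* u :+ v :* (:0 :* :0) := :0) refl _ _ ⟩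
          0# ∎)
          where
          open ≡-Reasoning
          y = σ s
          z = σ y
          -- Eliminating z from y (z² + 1) = 1 and z (s² + 1) = 1 gives y s⁴ = (s + 1)⁴, which then
          -- removes y from s (y² + 1) = 1 and leaves s⁸ = s.
          W = y * s ^ 4 + (s + 1#) ^ 4
          Pyz≡0 : P y z ≡ 0#
          Pyz≡0 = σ-P s y P≡0
          Pzs≡0 : P z s ≡ 0#
          Pzs≡0 = subst (λ t → P z t ≡ 0#) (σ³≡id s) (σ-P y z Pyz≡0)
          W≡0 : W ≡ 0#
          W≡0 = begin
            y * s ^ 4 + (s + 1#) ^ 4
              ≡⟨ solve 3 (λ s y z → y :* s :^ 4 :+ (s :+ :1) :^ 4 := (y :* (z :* z) :+ y :+ :1) :* (s :+ :1) :^ 4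
                   :+ y :* ((z :* (s :* s) :+ z :+ :1) :* (z :* (s :* s) :+ z :+ :1))) refl s y z ⟩
            P y z * (s + 1#) ^ 4 + y * (P z s * P z s)
              ≡⟨ cong₂ (λ u v → u * (s + 1#) ^ 4 + y * (v * v)) Pyz≡0 Pzs≡0 ⟩
            0# * (s + 1#) ^ 4 + y * (0# * 0#)
              ≡⟨ solve 2 (λ u v → :0 :* u :+ v :* (:0 :* :0) := :0) refl _ _ ⟩
            0# ∎

      open RootCount j P (P-descends (σ r₃) (σ r₁) a σr₃≡r₁ σr₁≡r₁+r₃ product≡a) P⇒𝔽₈ hiding (f; σ)

      private
        -- As σ r₃ = r₁, the values of f and of the cubic at r₃ differ by r₃ (r₁ + r₃)².
        fr₃≢0 : f r₃ ≢ 0#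
        fr₃≢0 fr₃≡0 = *-≢0 r₃≢0 r₁+r₃≢0 (x*y≡0 (trans
          (solve 3 (λ r₁ r₃ a → (r₁ :+ r₃) :* (r₃ :* (r₁ :+ r₃))
              := (r₃ :* (r₁ :* r₁) :+ r₃ :+ a) :+ (r₃ :^ 3 :+ r₃ :+ a)) refl r₁ r₃ a)
          (trans (cong₂ _+_ (trans (cong (λ t → r₃ * (t * t) + r₃ + a)
              (sym σr₃≡r₁)) fr₃≡0) r₃-root) (+-identityˡ 0#))) r₁+r₃≢0)

      count-0-mod-3 : ∀ t → j ≡ t ℕ.* 3 → numRoots f ≡ 3
      count-0-mod-3 t j≡ = count-without-r₃ (record
        { unique   = roots-α-unique αw≡0
        ; in-𝔽₈    = λ s∈ → α≡0⇒𝔽₈ (roots-α-sound αw≡0 s∈)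
        ; sound    = λ s∈ → let α≡0 = roots-α-sound αw≡0 s∈ in trans (P≡α (α≡0⇒𝔽₈ α≡0)) α≡0
        ; complete = λ s⁸≡s P≡0 → roots-α-complete αw≡0 (trans (sym (P≡α s⁸≡s)) P≡0)
        }) fr₃≢0
        where
        P≡α : ∀ {s} → s ^ 8 ≡ s → P s (σ s) ≡ α s
        P≡α {s} s⁸≡s = trans (cong (P s) (frobenius-0-mod-3 s⁸≡s t j≡))
          (solve 1 (λ s → s :* (s :* s) :+ s :+ :1 := s :^ 3 :+ s :+ :1) refl s)

      count-1-mod-3 : ∀ t → j ≡ 1 ℕ.+ t ℕ.* 3 → numRoots f ≡ 3
      count-1-mod-3 t j≡ = count-without-r₃ (record
        { unique   = roots-β-unique αw≡0
        ; in-𝔽₈    = λ s∈ → β≡0⇒𝔽₈ (roots-β-sound αw≡0 s∈)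
        ; sound    = λ {s} s∈ → let β≡0 = roots-β-sound αw≡0 s∈ in
            trans (P≡ (β≡0⇒𝔽₈ β≡0)) (trans (cong ((s * s + s + 1#) *_) β≡0) (zeroʳ _))
        ; complete = λ s⁸≡s P≡0 → roots-β-complete αw≡0
            (x*y≡0 (trans (sym (P≡ s⁸≡s)) P≡0) (no-cube-root-of-unity-in-𝔽₈ s⁸≡s))
        }) fr₃≢0
        where
        P≡ : ∀ {s} → s ^ 8 ≡ s → P s (σ s) ≡ (s * s + s + 1#) * β s
        P≡ {s} s⁸≡s = trans (cong (P s) (frobenius-1-mod-3 s⁸≡s t j≡))
          (solve 1 (λ s → s :* (s :* s :* (s :* s)) :+ s :+ :1 := (s :* s :+ s :+ :1) :* (s :^ 3 :+ s :* s :+ :1))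
              refl s)

      count-2-mod-3 : ∀ t → j ≡ 2 ℕ.+ t ℕ.* 3 → numRoots f ≡ 0
      count-2-mod-3 t j≡ = count-without-r₃ {[]} (record
        { unique   = []
        ; in-𝔽₈    = λ ()
        ; sound    = λ ()
        ; complete = λ {s} s⁸≡s P≡0 → contradiction (trans (sym (P≡ s⁸≡s)) P≡0) (no-cube-root-of-unity-in-𝔽₈ s⁸≡s)
        }) fr₃≢0
        where
        P≡ : ∀ {s} → s ^ 8 ≡ s → P s (σ s) ≡ s * s + s + 1#
        P≡ {s} s⁸≡s = begin
          P s (σ s)                                                      ≡⟨ cong (P s) (frobenius-2-mod-3 s⁸≡s t j≡) ⟩
          s * (s * s * (s * s) * (s * s * (s * s))) + s + 1#
            ≡⟨ solve 1 (λ s → s :* (s :* s :* (s :* s) :* (s :* s :* (s :* s))) :+ s :+ :1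
                := s :* s :^ 8 :+ s :+ :1) refl s ⟩
          s * s ^ 8 + s + 1#                                             ≡⟨ cong (λ u → s * u + s + 1#) s⁸≡s ⟩
          s * s + s + 1#                                                 ∎
          where open ≡-Reasoning

-- The count for σ(x) = x^(q^ℓ)

module Counting (m-1 : ℕ) (K : GF2Field (3 ℕ.* suc m-1)) where
  open GF2Field K hiding (dickson) renaming (Carrier to C)
  open FiniteField K
  open CubicFields m-1 K

  private
    frobenius-cycle : ∀ k x → x ^ (q ℕ.^ (k ℕ.* 3)) ≡ x
    frobenius-cycle zero    x = *-identityʳ x
    frobenius-cycle (suc k) x = begin
      x ^ (q ℕ.* (q ℕ.* (q ℕ.* Q)))   ≡⟨ ^-assocʳ x q (q ℕ.* (q ℕ.* Q)) ⟨
      (x ^ q) ^ (q ℕ.* (q ℕ.* Q))     ≡⟨ ^-assocʳ (x ^ q) q (q ℕ.* Q) ⟨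
      ((x ^ q) ^ q) ^ (q ℕ.* Q)       ≡⟨ ^-assocʳ ((x ^ q) ^ q) q Q ⟨
      (((x ^ q) ^ q) ^ q) ^ Q         ≡⟨ cong (_^ Q) (frobenius³ x) ⟩
      x ^ Q                           ≡⟨ frobenius-cycle k x ⟩
      x                               ∎
      where
      open ≡-Reasoning
      Q = q ℕ.^ (k ℕ.* 3)

    fermat-iterated : ∀ ℓ x → x ^ ((2 ℕ.^ (3 ℕ.* m)) ℕ.^ ℓ) ≡ x
    fermat-iterated zero    x = *-identityʳ x
    fermat-iterated (suc ℓ) x = trans (sym (^-assocʳ x (2 ℕ.^ (3 ℕ.* m)) _))
      (trans (cong (_^ ((2 ℕ.^ (3 ℕ.* m)) ℕ.^ ℓ)) (fermat x)) (fermat-iterated ℓ x))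

  module _
    (a : C) (a^q≡a : a ^ q ≡ a) (a≢0 : a ≢ 0#) (a≢1 : a ≢ 1#) (Tr-a⁻¹≡Tr-1 : Tr m (a ⁻¹) ≡ Tr m 1#)
    (ℓ : ℕ) (3∤ℓ : ¬ (3 ∣ ℓ))
    where

    open RootsOfCubic a a^q≡a a≢0 Tr-a⁻¹≡Tr-1

    private
      j : ℕ
      j = m ℕ.* ℓ

      σ : C → C
      σ x = x ^ (2 ℕ.^ j)

      σ≡ : ∀ x → σ x ≡ x ^ (q ℕ.^ ℓ)
      σ≡ x = cong (x ^_) (sym (ℕₚ.^-*-assoc 2 m ℓ))

      σ³≡id : ∀ x → σ (σ (σ x)) ≡ x
      σ³≡id x = begin
        σ (σ (σ x))                       ≡⟨ ^-2^[3*] j x ⟩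
        x ^ (2 ℕ.^ (3 ℕ.* (m ℕ.* ℓ)))     ≡⟨ cong (λ i → x ^ (2 ℕ.^ i)) (ℕₚ.*-assoc 3 m ℓ) ⟨
        x ^ (2 ℕ.^ (3 ℕ.* m ℕ.* ℓ))       ≡⟨ cong (x ^_) (ℕₚ.^-*-assoc 2 (3 ℕ.* m) ℓ) ⟨
        x ^ ((2 ℕ.^ (3 ℕ.* m)) ℕ.^ ℓ)     ≡⟨ fermat-iterated ℓ x ⟩
        x                                 ∎
        where open ≡-Reasoning

      -- The cube of the q-power map is the identity on K, so only ℓ modulo 3 matters.
      σ-cases : (∀ x → σ x ≡ x ^ q) ⊎ (∀ x → σ x ≡ (x ^ q) ^ q)
      σ-cases with nonzero-residue 3∤ℓ
      ... | inj₁ (k , ℓ≡) = inj₁ (λ x → trans (σ≡ x) (trans (cong (λ i → x ^ (q ℕ.^ i)) ℓ≡)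
              (trans (sym (^-assocʳ x q _)) (frobenius-cycle k (x ^ q)))))
      ... | inj₂ (k , ℓ≡) = inj₂ (λ x → trans (σ≡ x) (trans (cong (λ i → x ^ (q ℕ.^ i)) ℓ≡)
              (trans (sym (^-assocʳ x q _)) (trans (sym (^-assocʳ (x ^ q) q _)) (frobenius-cycle k ((x ^ q) ^ q))))))

    N : ℕ
    N = numRoots (λ x → pow x (2 ℕ.* (q ℕ.^ ℓ) ℕ.+ 1) + x + a)

    private
      N≡ : N ≡ numRoots (λ x → x * (σ x * σ x) + x + a)
      N≡ = numRoots-cong (λ x → cong (λ t → t + x + a) (begin
        pow x (2 ℕ.* Q ℕ.+ 1)       ≡⟨ pow≡^ x (2 ℕ.* Q ℕ.+ 1) ⟩
        x ^ (2 ℕ.* Q ℕ.+ 1)         ≡⟨ cong (x ^_) (ℕsolve 1 (λ Q → κ 2 ⊗ Q ⊕ κ 1 ⊜ κ 1 ⊕ (Q ⊕ Q)) refl Q) ⟩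
        x * x ^ (Q ℕ.+ Q)           ≡⟨ cong (x *_) (^-homo-* x Q Q) ⟩
        x * (x ^ Q * x ^ Q)         ≡⟨ cong (λ t → x * (t * t)) (σ≡ x) ⟨
        x * (σ x * σ x)             ∎))
        where
        open ≡-Reasoning
        Q = q ℕ.^ ℓ

      Count : ℕ → Set
      Count N₂ = (¬ (3 ∣ ℓ ℕ.+ m) → N ≡ 3) × (3 ∣ ℓ ℕ.+ m → N ≡ N₂)

      by-residue : ∀ {N₂} (let N′ = numRoots (λ x → x * (σ x * σ x) + x + a)) →
        (∀ t → j ≡ t ℕ.* 3 → N′ ≡ 3) → (∀ t → j ≡ 1 ℕ.+ t ℕ.* 3 → N′ ≡ 3) → (∀ t → j ≡ 2 ℕ.+ t ℕ.* 3 → N′ ≡ N₂) →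
        Count N₂
      by-residue c₀ c₁ c₂ with product-residue {ℓ} {m} 3∤ℓ
      ... | inj₁ (3∣ , t , j≡)        = (λ 3∤ → contradiction 3∣ 3∤) , (λ _ → trans N≡ (c₂ t j≡))
      ... | inj₂ (3∤ , inj₁ (t , j≡)) = (λ _ → trans N≡ (c₀ t j≡)) , (λ 3∣ → contradiction 3∣ 3∤)
      ... | inj₂ (3∤ , inj₂ (t , j≡)) = (λ _ → trans N≡ (c₁ t j≡)) , (λ 3∣ → contradiction 3∣ 3∤)

      root≢0 : ∀ {r} → cubic r ≡ 0# → r ≢ 0#
      root≢0 {r} root r≡0 = a≢0 (trans (solve 1 (λ a → a := :0 :^ 3 :+ :0 :+ a) refl a)
          (subst (λ t → cubic t ≡ 0#) r≡0 root))

      cubic-frobenius : ∀ {r} → cubic r ≡ 0# → cubic (r ^ q) ≡ 0#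
      cubic-frobenius {r} root = begin
        (r ^ q) ^ 3 + r ^ q + a           ≡⟨ cong₂ (λ u v → u + r ^ q + v)
            (trans (^-assocʳ r q 3) (trans (cong (r ^_) (ℕₚ.*-comm q 3)) (sym (^-assocʳ r 3 q)))) (sym a^q≡a) ⟩
        (r ^ 3) ^ q + r ^ q + a ^ q       ≡⟨ cong (_+ a ^ q) (frobenius-+ m (r ^ 3) r) ⟨
        (r ^ 3 + r) ^ q + a ^ q           ≡⟨ frobenius-+ m (r ^ 3 + r) a ⟨
        cubic r ^ q                       ≡⟨ cong (_^ q) (trans root (sym (double 0#))) ⟩
        (0# + 0#) ^ q                     ≡⟨ frobenius-+ m 0# 0# ⟩
        0# ^ q + 0# ^ q                   ≡⟨ double _ ⟩
        0#                                ∎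
        where open ≡-Reasoning

    count-δ≡0 : δ ≡ 0# → Count 9
    count-δ≡0 δ≡0 = from two-roots
      where
      σ-fixes : ∀ {r} → cubic r ≡ 0# → σ r ≡ r
      σ-fixes {r} root = [ (λ σ≡F → trans (σ≡F r) F-fixes) ,
          (λ σ≡F² → trans (σ≡F² r) (trans (cong (_^ q) F-fixes) F-fixes)) ]′ σ-cases
        where
        F-fixes : r ^ q ≡ r
        F-fixes = root-frobenius-δ≡0 root δ≡0
      open RootCounts K using (module RootsFixed)
      from : (∃₂ λ r s → r ≢ s × cubic r ≡ 0# × cubic s ≡ 0#) → Count 9
      from (r₁ , r₃ , r₁≢r₃ , r₁-root , r₃-root) = by-residue count-0-mod-3 count-1-mod-3 count-2-mod-3
        where
        open RootsFixed a r₁ r₃ a≢0 a≢1 r₁-root r₃-root r₁≢r₃ j σ³≡id (proj₂ 𝔽₈-generator) (σ-fixes r₁-root) (σ-fixes r₃-root)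

    private
      module CycledRoots (δ≡1 : δ ≡ 1#) {r : C} (r-root : cubic r ≡ 0#) where
        open RootCounts K using (module RootsCycled)

        y z : C
        y = r ^ q
        z = y ^ q

        z≡r+y : z ≡ r + y
        z≡r+y = root-frobenius²-δ≡1 r-root δ≡1

        z≢r : z ≢ r
        z≢r z≡r = root≢0 (cubic-frobenius r-root) (begin
          y             ≡⟨ solve 2 (λ r y → y := r :+ (r :+ y)) refl r y ⟩
          r + (r + y)   ≡⟨ cong (r +_) (trans (sym z≡r+y) z≡r) ⟩
          r + r         ≡⟨ double r ⟩
          0#            ∎)
          where open ≡-Reasoning

        -- In both cases r₃ = r and r₁ = σ r, which is y or z. The two 3-cycles are inverse to each
        -- other, and labelling the roots along σ brings both into the form that `RootsCycled`
        -- expects.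
        count : (∀ x → σ x ≡ x ^ q) ⊎ (∀ x → σ x ≡ (x ^ q) ^ q) → Count 0
        count (inj₁ σ≡F) = by-residue count-0-mod-3 count-1-mod-3 count-2-mod-3
          where
          open RootsCycled a y r a≢0 a≢1 (cubic-frobenius r-root) r-root (root-frobenius-δ≡1 r-root δ≡1)
            j σ³≡id (proj₂ 𝔽₈-generator) (σ≡F r) (trans (σ≡F y) (trans z≡r+y (+-comm r y)))
        count (inj₂ σ≡F²) = by-residue count-0-mod-3 count-1-mod-3 count-2-mod-3
          where
          σz≡z+r : σ z ≡ z + r
          σz≡z+r = begin
            σ z                   ≡⟨ σ≡F² z ⟩
            (z ^ q) ^ q           ≡⟨ cong (_^ q) (frobenius³ r) ⟩
            y                     ≡⟨ solve 2 (λ r y → y := r :+ y :+ r) refl r y ⟩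
            r + y + r             ≡⟨ cong (_+ r) z≡r+y ⟨
            z + r                 ∎
            where open ≡-Reasoning
          open RootsCycled a z r a≢0 a≢1 (cubic-frobenius (cubic-frobenius r-root)) r-root z≢r
            j σ³≡id (proj₂ 𝔽₈-generator) (σ≡F² r) σz≡z+r

    count-δ≡1 : δ ≡ 1# → Count 0
    count-δ≡1 δ≡1 = from two-roots
      where
      from : (∃₂ λ r s → r ≢ s × cubic r ≡ 0# × cubic s ≡ 0#) → Count 0
      from (_ , _ , _ , r-root , _) = CycledRoots.count δ≡1 r-root σ-cases

    root-count : (¬ (3 ∣ ℓ ℕ.+ m) → N ≡ 3)
               × (3 ∣ ℓ ℕ.+ m → (N ≡ 0 ⊎ N ≡ 9) × (N ≡ 9 ⇔ GF2Field.dickson K n a ≡ 0#))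
    root-count with δ≡0⊎δ≡1
    ... | inj₁ δ≡0 = let N≡3 , N≡9 = count-δ≡0 δ≡0 in
      N≡3 , λ 3∣ → inj₂ (N≡9 3∣) , mk⇔ (λ _ → trans (dickson≡ n a) δ≡0) (λ _ → N≡9 3∣)
    ... | inj₂ δ≡1 = let N≡3 , N≡0 = count-δ≡1 δ≡1 in
      N≡3 , λ 3∣ → inj₁ (N≡0 3∣) , mk⇔
        (λ N≡9 → contradiction (trans (sym (N≡0 3∣)) N≡9) λ ())
        (λ D≡0 → contradiction (trans (sym D≡0) (trans (dickson≡ n a) δ≡1)) 0≢1)

open import Data.Nat using (ℕ; _+_; _*_; _^_; _/_; _<_)

theorem1p1 : (ℓ m : ℕ) → 0 < ℓ → 0 < m → ¬ (3 ∣ ℓ) →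
    (K : GF2Field (3 * m)) → (a : GF2Field.Carrier K) →
    let q = 2 ^ m
        n = (q + 1) / 3
        N = GF2Field.numRoots K (λ x → GF2Field._+_ K (GF2Field._+_ K (GF2Field.pow K x (2 * (q ^ ℓ) + 1)) x) a)
    in GF2Field.pow K a q ≡ a → a ≢ GF2Field.0# K → a ≢ GF2Field.1# K →
       GF2Field.Tr K m (GF2Field._⁻¹ K a) ≡ GF2Field.Tr K m (GF2Field.1# K) →
       ((¬ (3 ∣ (ℓ + m))) → N ≡ 3)
       × ((3 ∣ (ℓ + m)) → (N ≡ 0 ⊎ N ≡ 9) × (N ≡ 9 ⇔ GF2Field.dickson K n a ≡ GF2Field.0# K))
theorem1p1 ℓ (suc m-1) _ _ 3∤ℓ K a a^q≡a a≢0 a≢1 Tr-a⁻¹≡Tr-1 =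
  Counting.root-count m-1 K a (trans (sym (FiniteField.pow≡^ K a (2 ^ suc m-1))) a^q≡a) a≢0 a≢1 Tr-a⁻¹≡Tr-1 ℓ 3∤ℓ
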